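{- Let $d>2$ be an integer. The average value of $h_p(\vec t)$ as $\vec t$ varies is $O(p^{\frac{d-1}{d}}\log p)$: there is a constant $C_d$ such that for every prime $p$, $$\mathbb{E}_{\vec t}\,[h_p(\vec t)]\ \le\ C_d\,p^{\frac{d-1}{d}}\log p,$$ where $\vec t=(t_1,\dots,t_{d-1},1)$ with $(t_1,\dots,t_{d-1})$ uniformly distributed in $\mathbb{Z}_p^{d-1}$.
   Context: $\mathbb{Z}_p=\mathbb{Z}/p\mathbb{Z}$. For $\vec t=(t_1,\dots,t_{d-1},1)\in\mathbb{Z}_p^d$, $$h_p(\vec{t}):=\min_{0<a<p}\ \max\big((at_1)\bmod p,\dots,(at_{d-1})\bmod p,\ a\big),$$ where $a$ ranges over integers and $m\bmod p$ denotes the representative in $\{0,1,\dots,p-1\}$. -}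

module Defs where

open import Data.Nat.Base as ℕ using (ℕ; zero; suc; NonZero; _^_; _∸_)
import Data.Nat.Properties as ℕ
open import Data.Nat.DivMod using (_%_)
open import Data.Nat.ListAction using (sum)
open import Data.Nat.Tactic.RingSolver using (solve-∀)
open import Data.Integer.Base as ℤ using (+_)
import Data.Integer.Properties as ℤ
open import Data.Fin.Base using (Fin; toℕ)
open import Data.List.Base using (List; []; _∷_; map; upTo; allFin; cartesianProductWith)
open import Data.List.Extrema.Nat using (min; max)
open import Data.Vec.Base as Vec using (Vec; []; _∷_)
open import Data.Product.Base using (∃-syntax; _,_; proj₁; proj₂)
open import Data.Sum.Base using (inj₁; inj₂)
open import Data.Rational.Base as ℚ
  using (ℚ; mkℚ; 0ℚ; 1ℚ; _+_; _*_; _-_; -_; _/_; _≤_; _<_; ∣_∣; toℚᵘ; 1/_; *<*)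
import Data.Rational.Properties as ℚ
open import Data.Rational.Unnormalised.Base as ℚᵘ using (mkℚᵘ; *≤*; *≡*)
import Data.Rational.Unnormalised.Properties as ℚᵘ
open import Data.Rational.Solver using (module +-*-Solver)
open import Relation.Nullary using (yes; no; contradiction)
open import Relation.Binary.PropositionalEquality
  using (_≡_; refl; sym; trans; cong; cong₂; subst; subst₂)

-- The coordinates t₁, …, t_{d-1} of t are stored as canonical
-- representatives; the last coordinate of t is 1 and contributes `a`,
-- since a mod p = a for 0 < a < p.
height : ∀ {m} (p : ℕ) .{{_ : NonZero p}} → Vec (Fin p) m → ℕ → ℕ
height p t a = max a (Vec.toList (Vec.map (λ tᵢ → (a ℕ.* toℕ tᵢ) % p) t))

-- `min x xs` is the minimum of x ∷ xs. As a = 1 occurs among 1, …, p - 1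
-- whenever p ≥ 2, the first argument does not change the minimum.
h : ∀ {m} (p : ℕ) .{{_ : NonZero p}} → Vec (Fin p) m → ℕ
h p t = min (height p t 1) (map (λ k → height p t (suc k)) (upTo (p ∸ 1)))

allVecs : ∀ p m → List (Vec (Fin p) m)
allVecs p zero    = [] ∷ []
allVecs p (suc m) = cartesianProductWith _∷_ (allFin p) (allVecs p m)

-- Expectation over the uniform distribution on the p ^ m vectors.
𝔼 : ∀ {m} p .{{_ : NonZero p}} → (Vec (Fin p) m → ℕ) → ℚ
𝔼 {m} p f = _/_ (+ sum (map f (allVecs p m))) (p ^ m) {{ℕ.m^n≢0 p m}}

record ℝ : Set where
  field
    seq    : ℕ → ℚ
    cauchy : ∀ ε → 0ℚ < ε →
             ∃[ N ] ∀ m n → N ℕ.≤ m → N ℕ.≤ n → ∣ seq m - seq n ∣ ≤ ε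

open ℝ public

infix 4 _≤ᵣ_
infixl 7 _*ᵣ_

-- The order of the limits, not a termwise order.
_≤ᵣ_ : ℝ → ℝ → Set
x ≤ᵣ y = ∀ ε → 0ℚ < ε → ∃[ N ] ∀ n → N ℕ.≤ n → seq x n ≤ seq y n + ε

fromℚ : ℚ → ℝ
fromℚ q .seq _ = q
fromℚ q .cauchy ε 0<ε = 0 , λ _ _ _ _ →
  subst (λ r → ∣ r ∣ ≤ ε) (sym (ℚ.+-inverseʳ q)) (ℚ.<⇒≤ 0<ε)

private
  ∣∣-split : ∀ p q → ∣ p ∣ ≤ ∣ p - q ∣ + ∣ q ∣
  ∣∣-split p q = subst (λ r → ∣ r ∣ ≤ ∣ p - q ∣ + ∣ q ∣) eq
                   (ℚ.∣p+q∣≤∣p∣+∣q∣ (p - q) q)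
    where
    open +-*-Solver
    eq : p - q + q ≡ p
    eq = solve 2 (λ p q → p :- q :+ q := p) refl p q

  0<1 : 0ℚ < 1ℚ
  0<1 = ℚ.positive⁻¹ 1ℚ

  bound : ℝ → ℚ
  bound x = 1ℚ + ∣ seq x (proj₁ (cauchy x 1ℚ 0<1)) ∣

  bounded : ∀ x n → proj₁ (cauchy x 1ℚ 0<1) ℕ.≤ n → ∣ seq x n ∣ ≤ bound x
  bounded x n N≤n = ℚ.≤-trans (∣∣-split (seq x n) (seq x N))
    (ℚ.+-monoˡ-≤ ∣ seq x N ∣ (proj₂ (cauchy x 1ℚ 0<1) n N N≤n ℕ.≤-refl))
    where N = proj₁ (cauchy x 1ℚ 0<1)

  bound-pos : ∀ x → ℚ.Positive (bound x)
  bound-pos x = ℚ.pos+nonNeg⇒pos 1ℚ {{_}} ∣ r ∣ {{ℚ.∣-∣-nonNeg r}}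
    where r = seq x (proj₁ (cauchy x 1ℚ 0<1))

  *-mono-∣∣ : ∀ {p q b c} → .{{ℚ.NonNegative c}} → ∣ p ∣ ≤ b → ∣ q ∣ ≤ c →
              ∣ p * q ∣ ≤ b * c
  *-mono-∣∣ {p} {q} {b} {c} p≤b q≤c = begin
    ∣ p * q ∣      ≡⟨ ℚ.∣p*q∣≡∣p∣*∣q∣ p q ⟩
    ∣ p ∣ * ∣ q ∣  ≤⟨ ℚ.*-monoˡ-≤-nonNeg ∣ p ∣ {{ℚ.∣-∣-nonNeg p}} q≤c ⟩
    ∣ p ∣ * c      ≤⟨ ℚ.*-monoʳ-≤-nonNeg c p≤b ⟩
    b * c          ∎
    where open ℚ.≤-Reasoning

_*ᵣ_ : ℝ → ℝ → ℝ
(x *ᵣ y) .seq n = seq x n * seq y n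
(x *ᵣ y) .cauchy ε 0<ε = N , close
  where
  B = bound x + bound y
  instance
    B-pos : ℚ.Positive B
    B-pos = ℚ.pos+pos⇒pos (bound x) {{bound-pos x}} (bound y) {{bound-pos y}}
    B≢0 : ℚ.NonZero B
    B≢0 = ℚ.pos⇒nonZero B
    1/B-pos : ℚ.Positive (1/ B)
    1/B-pos = ℚ.1/pos⇒pos B
  δ = ε * 1/ B
  instance
    δ-pos : ℚ.Positive δ
    δ-pos = ℚ.pos*pos⇒pos ε {{ℚ.positive 0<ε}} (1/ B)
    δ-nonNeg : ℚ.NonNegative δ
    δ-nonNeg = ℚ.pos⇒nonNeg δ
    by-nonNeg : ℚ.NonNegative (bound y)
    by-nonNeg = ℚ.pos⇒nonNeg (bound y) {{bound-pos y}}
  0<δ : 0ℚ < δ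
  0<δ = ℚ.positive⁻¹ δ
  Nx = proj₁ (cauchy x 1ℚ 0<1)
  Ny = proj₁ (cauchy y 1ℚ 0<1)
  Mx = proj₁ (cauchy x δ 0<δ)
  My = proj₁ (cauchy y δ 0<δ)
  N = (Nx ℕ.⊔ Ny) ℕ.⊔ (Mx ℕ.⊔ My)

  total : bound x * δ + δ * bound y ≡ ε
  total = trans (solve 4 (λ bx by e i → bx :* (e :* i) :+ (e :* i) :* by
                                     := e :* ((bx :+ by) :* i))
                         refl (bound x) (bound y) ε (1/ B))
          (trans (cong (ε *_) (ℚ.*-inverseʳ B)) (ℚ.*-identityʳ ε))
    where open +-*-Solver

  close : ∀ m n → N ℕ.≤ m → N ℕ.≤ n →
          ∣ seq x m * seq y m - seq x n * seq y n ∣ ≤ ε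
  close m n N≤m N≤n = begin
    ∣ a * b - c * d ∣
      ≡⟨ cong ∣_∣ (solve 4 (λ a b c d → a :* b :- c :* d
                                     := a :* (b :- d) :+ (a :- c) :* d)
                           refl a b c d) ⟩
    ∣ a * (b - d) + (a - c) * d ∣
      ≤⟨ ℚ.∣p+q∣≤∣p∣+∣q∣ (a * (b - d)) ((a - c) * d) ⟩
    ∣ a * (b - d) ∣ + ∣ (a - c) * d ∣
      ≤⟨ ℚ.+-mono-≤
           (*-mono-∣∣ (bounded x m (via Nx≤ N≤m))
                      (proj₂ (cauchy y δ 0<δ) m n (via My≤ N≤m) (via My≤ N≤n)))
           (*-mono-∣∣ (proj₂ (cauchy x δ 0<δ) m n (via Mx≤ N≤m) (via Mx≤ N≤n))
                      (bounded y n (via Ny≤ N≤n))) ⟩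
    bound x * δ + δ * bound y
      ≡⟨ total ⟩
    ε ∎
    where
    open ℚ.≤-Reasoning
    open +-*-Solver
    a = seq x m
    b = seq y m
    c = seq x n
    d = seq y n
    via : ∀ {i j k} → i ℕ.≤ j → j ℕ.≤ k → i ℕ.≤ k
    via = ℕ.≤-trans
    Nx≤ : Nx ℕ.≤ N
    Nx≤ = via (ℕ.m≤m⊔n Nx Ny) (ℕ.m≤m⊔n _ _)
    Ny≤ : Ny ℕ.≤ N
    Ny≤ = via (ℕ.m≤n⊔m Nx Ny) (ℕ.m≤m⊔n _ _)
    Mx≤ : Mx ℕ.≤ N
    Mx≤ = via (ℕ.m≤m⊔n Mx My) (ℕ.m≤n⊔m (Nx ℕ.⊔ Ny) _)
    My≤ : My ℕ.≤ N
    My≤ = via (ℕ.m≤n⊔m Mx My) (ℕ.m≤n⊔m (Nx ℕ.⊔ Ny) _)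

infixl 7 _/2^_
_/2^_ : ℕ → ℕ → ℚ
a /2^ n = _/_ (+ a) (2 ^ n) {{ℕ.m^n≢0 2 n}}

frac-≤ : ∀ a b c d .{{_ : NonZero b}} .{{_ : NonZero d}} →
         a ℕ.* d ℕ.≤ c ℕ.* b → + a / b ≤ + c / d
frac-≤ a (suc b) c (suc d) le = ℚ.toℚᵘ-cancel-≤
  (ℚᵘ.≤-respˡ-≃ (ℚᵘ.≃-sym (ℚ.toℚᵘ-fromℚᵘ (mkℚᵘ (+ a) b)))
  (ℚᵘ.≤-respʳ-≃ (ℚᵘ.≃-sym (ℚ.toℚᵘ-fromℚᵘ (mkℚᵘ (+ c) d)))
    (*≤* (subst₂ ℤ._≤_ (ℤ.pos-* a (suc d)) (ℤ.pos-* c (suc b)) (ℤ.+≤+ le)))))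

frac-≡ : ∀ a b c d .{{_ : NonZero b}} .{{_ : NonZero d}} →
         a ℕ.* d ≡ c ℕ.* b → + a / b ≡ + c / d
frac-≡ a b c d eq = ℚ.≤-antisym (frac-≤ a b c d (ℕ.≤-reflexive eq))
                                (frac-≤ c d a b (ℕ.≤-reflexive (sym eq)))

frac-+ : ∀ a c b .{{_ : NonZero b}} → + a / b + + c / b ≡ + (a ℕ.+ c) / b
frac-+ a c (suc b) = ℚ.toℚᵘ-injective
  (ℚᵘ.≃-trans (ℚ.toℚᵘ-homo-+ (+ a / suc b) (+ c / suc b))
  (ℚᵘ.≃-trans (ℚᵘ.+-cong (ℚ.toℚᵘ-fromℚᵘ (mkℚᵘ (+ a) b)) (ℚ.toℚᵘ-fromℚᵘ (mkℚᵘ (+ c) b)))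
  (ℚᵘ.≃-trans (*≡* same) (ℚᵘ.≃-sym (ℚ.toℚᵘ-fromℚᵘ (mkℚᵘ (+ (a ℕ.+ c)) b))))))
  where
  B = + suc b
  same : (+ a ℤ.* B ℤ.+ + c ℤ.* B) ℤ.* B ≡ + (a ℕ.+ c) ℤ.* + (suc b ℕ.* suc b)
  same = trans (cong (ℤ._* B) (sym (ℤ.*-distribʳ-+ B (+ a) (+ c))))
        (trans (ℤ.*-assoc (+ (a ℕ.+ c)) B B)
               (cong (+ (a ℕ.+ c) ℤ.*_) (sym (ℤ.pos-* (suc b) (suc b)))))

dyadic-≤ : ∀ a m c n → a ℕ.* 2 ^ n ℕ.≤ c ℕ.* 2 ^ m → a /2^ m ≤ c /2^ n
dyadic-≤ a m c n = frac-≤ a (2 ^ m) c (2 ^ n) {{ℕ.m^n≢0 2 m}} {{ℕ.m^n≢0 2 n}}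

dyadic-≡ : ∀ a m c n → a ℕ.* 2 ^ n ≡ c ℕ.* 2 ^ m → a /2^ m ≡ c /2^ n
dyadic-≡ a m c n = frac-≡ a (2 ^ m) c (2 ^ n) {{ℕ.m^n≢0 2 m}} {{ℕ.m^n≢0 2 n}}

dyadic-+ : ∀ a c n → a /2^ n + c /2^ n ≡ (a ℕ.+ c) /2^ n
dyadic-+ a c n = frac-+ a c (2 ^ n) {{ℕ.m^n≢0 2 n}}

n<2^n : ∀ n → n ℕ.< 2 ^ n
n<2^n zero    = ℕ.≤-refl
n<2^n (suc n) = ℕ.≤-trans (ℕ.+-mono-≤ (ℕ.m^n>0 2 n) (n<2^n n))
                  (ℕ.+-monoʳ-≤ (2 ^ n) (ℕ.m≤m+n (2 ^ n) 0))

archimedean : ∀ ε → 0ℚ < ε → ∃[ n ] (1 /2^ n ≤ ε)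
archimedean ε@(mkℚ ℤ.+[1+ a ] b _) _ = suc b , subst (1 /2^ suc b ≤_) (ℚ.↥p/↧p≡p ε)
  (frac-≤ 1 (2 ^ suc b) (suc a) (suc b) {{ℕ.m^n≢0 2 (suc b)}}
    (ℕ.≤-trans (ℕ.≤-reflexive (ℕ.*-identityˡ (suc b)))
    (ℕ.≤-trans (ℕ.<⇒≤ (n<2^n (suc b))) (ℕ.m≤m+n _ _))))
archimedean (mkℚ (+ 0) b _) (*<* (ℤ.+<+ ()))
archimedean (mkℚ ℤ.-[1+ a ] b _) (*<* ())

halves : ∀ n → 1 /2^ suc n + 1 /2^ suc n ≡ 1 /2^ n
halves n = trans (dyadic-+ 1 1 (suc n)) (dyadic-≡ 2 (suc n) 1 n (lem (2 ^ n)))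
  where
  lem : ∀ x → 2 ℕ.* x ≡ 1 ℕ.* (2 ℕ.* x)
  lem = solve-∀

∣∣-≤ : ∀ {p q} → p ≤ q → - p ≤ q → ∣ p ∣ ≤ q
∣∣-≤ {p} {q} p≤q -p≤q with ℚ.∣p∣≡p∨∣p∣≡-p p
... | inj₁ eq = subst (_≤ q) (sym eq) p≤q
... | inj₂ eq = subst (_≤ q) (sym eq) -p≤q

sub-≤ : ∀ p q r → p ≤ q + r → p - q ≤ r
sub-≤ p q r p≤ = subst (p - q ≤_)
  (solve 2 (λ q r → q :+ r :- q := r) refl q r) (ℚ.+-monoˡ-≤ (- q) p≤)
  where open +-*-Solver

neg-sub : ∀ p q → - (p - q) ≡ q - p
neg-sub = solve 2 (λ p q → :- (p :- q) := q :- p) refl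
  where open +-*-Solver

mkMonotone : (x : ℕ → ℚ) → (∀ n → x n ≤ x (suc n)) →
             (∀ n → x (suc n) ≤ x n + 1 /2^ suc n) → ℝ
mkMonotone x up step .seq = x
mkMonotone x up step .cauchy ε 0<ε = N , close
  where
  N = proj₁ (archimedean ε 0<ε)
  top : ℕ → ℚ
  top n = x n + 1 /2^ n

  top-down : ∀ n → top (suc n) ≤ top n
  top-down n = ℚ.≤-trans (ℚ.+-monoˡ-≤ (1 /2^ suc n) (step n)) (ℚ.≤-reflexive
    (trans (ℚ.+-assoc (x n) _ _) (cong (_+_ (x n)) (halves n))))

  x-mono : ∀ k n → x n ≤ x (k ℕ.+ n)
  x-mono zero    n = ℚ.≤-refl
  x-mono (suc k) n = ℚ.≤-trans (x-mono k n) (up (k ℕ.+ n))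

  top-mono : ∀ k n → top (k ℕ.+ n) ≤ top n
  top-mono zero    n = ℚ.≤-refl
  top-mono (suc k) n = ℚ.≤-trans (top-down (k ℕ.+ n)) (top-mono k n)

  x≤top : ∀ n → x n ≤ top n
  x≤top n = subst (_≤ top n) (ℚ.+-identityʳ (x n))
    (ℚ.+-monoʳ-≤ (x n) (dyadic-≤ 0 0 1 n ℕ.z≤n))

  lower : ∀ {n} → N ℕ.≤ n → x N ≤ x n
  lower {n} N≤n = subst (λ k → x N ≤ x k) (ℕ.m∸n+n≡m N≤n) (x-mono (n ∸ N) N)

  upper : ∀ {n} → N ℕ.≤ n → x n ≤ x N + ε
  upper {n} N≤n = ℚ.≤-trans (x≤top n) (ℚ.≤-trans
    (subst (λ k → top k ≤ top N) (ℕ.m∸n+n≡m N≤n) (top-mono (n ∸ N) N))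
    (ℚ.+-monoʳ-≤ (x N) (proj₂ (archimedean ε 0<ε))))

  close : ∀ m n → N ℕ.≤ m → N ℕ.≤ n → ∣ x m - x n ∣ ≤ ε
  close m n N≤m N≤n = ∣∣-≤
    (half N≤m N≤n) (subst (_≤ ε) (sym (neg-sub (x m) (x n))) (half N≤n N≤m))
    where
    half : ∀ {i j} → N ℕ.≤ i → N ℕ.≤ j → x i - x j ≤ ε
    half {i} {j} N≤i N≤j = sub-≤ (x i) (x j) ε
      (ℚ.≤-trans (upper N≤i) (ℚ.+-monoˡ-≤ ε (lower N≤j)))

private
  ^-distribʳ-* : ∀ k a b → (a ℕ.* b) ^ k ≡ a ^ k ℕ.* b ^ k
  ^-distribʳ-* zero    a b = refl
  ^-distribʳ-* (suc k) a b = trans (cong (a ℕ.* b ℕ.*_) (^-distribʳ-* k a b))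
                                   (lem a b (a ^ k) (b ^ k))
    where
    lem : ∀ a b x y → a ℕ.* b ℕ.* (x ℕ.* y) ≡ a ℕ.* x ℕ.* (b ℕ.* y)
    lem = solve-∀

-- The largest m ≤ b with m ^ k ≤ a (for k ≥ 1).
rootUpTo : ℕ → ℕ → ℕ → ℕ
rootUpTo k a zero = 0
rootUpTo k a (suc b) with suc b ^ k ℕ.≤? a
... | yes _ = suc b
... | no  _ = rootUpTo k a b

⌊root⌋ : ℕ → ℕ → ℕ
⌊root⌋ k a = rootUpTo k a a

⌊root⌋-lower : ∀ k .{{_ : NonZero k}} a → ⌊root⌋ k a ^ k ℕ.≤ a
⌊root⌋-lower k@(suc _) a = go a
  where
  go : ∀ b → rootUpTo k a b ^ k ℕ.≤ a
  go zero = ℕ.z≤n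
  go (suc b) with suc b ^ k ℕ.≤? a
  ... | yes le = le
  ... | no  _  = go b

⌊root⌋-maximal : ∀ k .{{_ : NonZero k}} a m → m ^ k ℕ.≤ a → m ℕ.≤ ⌊root⌋ k a
⌊root⌋-maximal k@(suc k′) a m m^k≤a = go a (ℕ.≤-trans (m≤m^k m) m^k≤a)
  where
  m≤m^k : ∀ m → m ℕ.≤ m ^ k
  m≤m^k zero = ℕ.z≤n
  m≤m^k m@(suc _) = ℕ.m≤m*n m (m ^ k′) {{ℕ.m^n≢0 m k′}}
  go : ∀ b → m ℕ.≤ b → m ℕ.≤ rootUpTo k a b
  go zero m≤b = m≤b
  go (suc b) m≤b with suc b ^ k ℕ.≤? a
  ... | yes _ = m≤b
  ... | no ¬le with ℕ.m≤n⇒m<n∨m≡n m≤b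
  ...   | inj₁ (ℕ.s≤s m≤b′) = go b m≤b′
  ...   | inj₂ refl = contradiction m^k≤a ¬le

-- a^(1/k), as the limit of ⌊ 2ⁿ · a^(1/k) ⌋ / 2ⁿ.
root : (k : ℕ) .{{_ : NonZero k}} → ℕ → ℝ
root k a = mkMonotone (λ n → r n /2^ n) up step
  where
  A : ℕ → ℕ
  A n = a ℕ.* (2 ^ n) ^ k
  r : ℕ → ℕ
  r n = ⌊root⌋ k (A n)

  A-suc : ∀ n → A (suc n) ≡ 2 ^ k ℕ.* A n
  A-suc n = trans (cong (a ℕ.*_) (^-distribʳ-* k 2 (2 ^ n))) (lem a (2 ^ k) ((2 ^ n) ^ k))
    where
    lem : ∀ a b c → a ℕ.* (b ℕ.* c) ≡ b ℕ.* (a ℕ.* c)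
    lem = solve-∀

  double : ∀ n → 2 ℕ.* r n ℕ.≤ r (suc n)
  double n = ⌊root⌋-maximal k (A (suc n)) (2 ℕ.* r n)
    (subst₂ ℕ._≤_ (sym (^-distribʳ-* k 2 (r n))) (sym (A-suc n))
      (ℕ.*-monoʳ-≤ (2 ^ k) (⌊root⌋-lower k (A n))))

  next : ∀ n → r (suc n) ℕ.≤ 2 ℕ.* r n ℕ.+ 1
  next n with r (suc n) ℕ.≤? 2 ℕ.* r n ℕ.+ 1
  ... | yes le = le
  ... | no ¬le = contradiction
      (⌊root⌋-maximal k (A n) (suc (r n)) (ℕ.*-cancelˡ-≤ (2 ^ k) {{ℕ.m^n≢0 2 k}}
        (subst₂ ℕ._≤_ (^-distribʳ-* k 2 (suc (r n))) (A-suc n)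
          (ℕ.≤-trans (ℕ.^-monoˡ-≤ k big) (⌊root⌋-lower k (A (suc n)))))))
      (ℕ.<-irrefl refl)
    where
    lem : ∀ x → suc (2 ℕ.* x ℕ.+ 1) ≡ 2 ℕ.* suc x
    lem = solve-∀
    big : 2 ℕ.* suc (r n) ℕ.≤ r (suc n)
    big = subst (ℕ._≤ r (suc n)) (lem (r n)) (ℕ.≰⇒> ¬le)

  twice : ∀ x y → x ℕ.* (2 ℕ.* y) ≡ (2 ℕ.* x) ℕ.* y
  twice = solve-∀

  up : ∀ n → r n /2^ n ≤ r (suc n) /2^ suc n
  up n = dyadic-≤ (r n) n (r (suc n)) (suc n)
    (subst (ℕ._≤ r (suc n) ℕ.* 2 ^ n) (sym (twice (r n) (2 ^ n)))
      (ℕ.*-monoˡ-≤ (2 ^ n) (double n)))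

  step : ∀ n → r (suc n) /2^ suc n ≤ r n /2^ n + 1 /2^ suc n
  step n = subst (r (suc n) /2^ suc n ≤_)
    (trans (sym (dyadic-+ (2 ℕ.* r n) 1 (suc n)))
           (cong (_+ 1 /2^ suc n)
             (dyadic-≡ (2 ℕ.* r n) (suc n) (r n) n (sym (twice (r n) (2 ^ n))))))
    (dyadic-≤ (r (suc n)) (suc n) (2 ℕ.* r n ℕ.+ 1) (suc n)
      (ℕ.*-monoˡ-≤ (2 ^ suc n) (next n)))

-- a ^ (j / k)
infix 8 _^[_/_]
_^[_/_] : ℕ → ℕ → (k : ℕ) → .{{NonZero k}} → ℝ
a ^[ j / k ] = root k (a ^ j)

∑ : ℕ → (ℕ → ℚ) → ℚ
∑ zero    f = 0ℚ
∑ (suc n) f = ∑ n f + f n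

-- log a = ∫₁ᵃ dx/x (a ≥ 1), as the limit of the lower Riemann sums of
-- mesh 1/m for m = 2ⁿ: the interval [1 + k/m, 1 + (k+1)/m] contributes
-- (1/m) · 1/(1 + (k+1)/m) = 1/(m + k + 1), and there are (a - 1)·m
-- intervals. The junk value log 0 is 0.
logSum : ℕ → ℕ → ℚ
logSum a m = ∑ ((a ∸ 1) ℕ.* m) (λ k → + 1 / suc (m ℕ.+ k))

log : ℕ → ℝ
log a = mkMonotone (λ n → logSum a (2 ^ n)) up step
  where
  f : ℕ → ℕ → ℚ
  f m k = + 1 / suc (m ℕ.+ k)

  ∑-double : ∀ M m → ∑ (2 ℕ.* M) (f (2 ℕ.* m))
                   ≡ ∑ M (λ k → + 1 / suc (2 ℕ.* (m ℕ.+ k)) + + 1 / suc (suc (2 ℕ.* (m ℕ.+ k))))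
  ∑-double zero    m = refl
  ∑-double (suc M) m = trans (cong (λ K → ∑ K (f (2 ℕ.* m))) (ℕ.*-suc 2 M))
    (trans (ℚ.+-assoc (∑ (2 ℕ.* M) (f (2 ℕ.* m))) _ _)
           (cong₂ _+_ (∑-double M m) (cong₂ _+_ (one (e₁ m M)) (one (e₂ m M)))))
    where
    one : ∀ {i j} → i ≡ j → + 1 / suc i ≡ + 1 / suc j
    one refl = refl
    e₁ : ∀ m M → 2 ℕ.* m ℕ.+ 2 ℕ.* M ≡ 2 ℕ.* (m ℕ.+ M)
    e₁ = solve-∀
    e₂ : ∀ m M → 2 ℕ.* m ℕ.+ suc (2 ℕ.* M) ≡ suc (2 ℕ.* (m ℕ.+ M))
    e₂ = solve-∀

  recip-≤ : ∀ {i j} → i ℕ.≤ j → + 1 / suc j ≤ + 1 / suc i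
  recip-≤ {i} {j} i≤j = frac-≤ 1 (suc j) 1 (suc i) (ℕ.*-monoʳ-≤ 1 (ℕ.s≤s i≤j))

  recip-halves : ∀ j → + 1 / suc (suc (2 ℕ.* j)) + + 1 / suc (suc (2 ℕ.* j)) ≡ + 1 / suc j
  recip-halves j = trans (frac-+ 1 1 (suc (suc (2 ℕ.* j))))
    (frac-≡ 2 (suc (suc (2 ℕ.* j))) 1 (suc j) (lem j))
    where
    lem : ∀ j → 2 ℕ.* suc j ≡ 1 ℕ.* suc (suc (2 ℕ.* j))
    lem = solve-∀

  refine-up : ∀ M m → ∑ M (f m) ≤ ∑ (2 ℕ.* M) (f (2 ℕ.* m))
  refine-up M m = subst (∑ M (f m) ≤_) (sym (∑-double M m)) (go M)
    where
    g : ℕ → ℚ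
    g k = + 1 / suc (2 ℕ.* (m ℕ.+ k)) + + 1 / suc (suc (2 ℕ.* (m ℕ.+ k)))
    go : ∀ M → ∑ M (f m) ≤ ∑ M g
    go zero    = ℚ.≤-refl
    go (suc M) = ℚ.+-mono-≤ (go M) (subst (_≤ g M) (recip-halves (m ℕ.+ M))
      (ℚ.+-monoˡ-≤ (+ 1 / suc (suc (2 ℕ.* (m ℕ.+ M)))) (recip-≤ (ℕ.n≤1+n (2 ℕ.* (m ℕ.+ M))))))

  -- 1/(2j+1) + 1/(2j+2) + 1/(2j+3) ≤ 1/(j+1) + 1/(2j+1) telescopes.
  refine-down : ∀ M m → ∑ (2 ℕ.* M) (f (2 ℕ.* m)) + + 1 / suc (2 ℕ.* (m ℕ.+ M))
                      ≤ ∑ M (f m) + + 1 / suc (2 ℕ.* m)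
  refine-down M m = subst (λ s → s + + 1 / suc (2 ℕ.* (m ℕ.+ M)) ≤ ∑ M (f m) + + 1 / suc (2 ℕ.* m))
                      (sym (∑-double M m)) (go M)
    where
    g : ℕ → ℚ
    g k = + 1 / suc (2 ℕ.* (m ℕ.+ k)) + + 1 / suc (suc (2 ℕ.* (m ℕ.+ k)))
    go : ∀ M → ∑ M g + + 1 / suc (2 ℕ.* (m ℕ.+ M)) ≤ ∑ M (f m) + + 1 / suc (2 ℕ.* m)
    go zero    = ℚ.+-monoʳ-≤ 0ℚ (ℚ.≤-reflexive (cong (λ i → + 1 / suc (2 ℕ.* i)) (ℕ.+-identityʳ m)))
    go (suc M) = begin
      S + (u + v) + w    ≤⟨ ℚ.+-monoʳ-≤ (S + (u + v)) w≤v ⟩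
      S + (u + v) + v    ≡⟨ solve 3 (λ S u v → S :+ (u :+ v) :+ v := S :+ u :+ (v :+ v)) refl S u v ⟩
      S + u + (v + v)    ≡⟨ cong (_+_ (S + u)) (recip-halves (m ℕ.+ M)) ⟩
      S + u + f m M      ≤⟨ ℚ.+-monoˡ-≤ (f m M) (go M) ⟩
      T + t + f m M      ≡⟨ solve 3 (λ T t x → T :+ t :+ x := T :+ x :+ t) refl T t (f m M) ⟩
      T + f m M + t      ∎
      where
      open ℚ.≤-Reasoning
      open +-*-Solver
      S = ∑ M g
      T = ∑ M (f m)
      t = + 1 / suc (2 ℕ.* m)
      u = + 1 / suc (2 ℕ.* (m ℕ.+ M))
      v = + 1 / suc (suc (2 ℕ.* (m ℕ.+ M)))
      w = + 1 / suc (2 ℕ.* (m ℕ.+ suc M))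
      le : suc (2 ℕ.* (m ℕ.+ M)) ℕ.≤ 2 ℕ.* (m ℕ.+ suc M)
      le = ℕ.≤-trans (ℕ.n≤1+n _) (ℕ.≤-reflexive (lem m M))
        where
        lem : ∀ m M → suc (suc (2 ℕ.* (m ℕ.+ M))) ≡ 2 ℕ.* (m ℕ.+ suc M)
        lem = solve-∀
      w≤v : w ≤ v
      w≤v = recip-≤ le

  cells : ∀ n → 2 ℕ.* ((a ∸ 1) ℕ.* 2 ^ n) ≡ (a ∸ 1) ℕ.* 2 ^ suc n
  cells n = lem (a ∸ 1) (2 ^ n)
    where
    lem : ∀ b x → 2 ℕ.* (b ℕ.* x) ≡ b ℕ.* (2 ℕ.* x)
    lem = solve-∀

  up : ∀ n → logSum a (2 ^ n) ≤ logSum a (2 ^ suc n)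
  up n = subst (λ K → logSum a (2 ^ n) ≤ ∑ K (f (2 ^ suc n))) (cells n)
           (refine-up ((a ∸ 1) ℕ.* 2 ^ n) (2 ^ n))

  step : ∀ n → logSum a (2 ^ suc n) ≤ logSum a (2 ^ n) + 1 /2^ suc n
  step n = begin
    logSum a (2 ^ suc n)         ≡⟨ cong (λ K → ∑ K (f (2 ^ suc n))) (cells n) ⟨
    s                            ≡⟨ ℚ.+-identityʳ s ⟨
    s + 0ℚ                       ≤⟨ ℚ.+-monoʳ-≤ s (frac-≤ 0 1 1 (suc (2 ℕ.* (2 ^ n ℕ.+ K))) ℕ.z≤n) ⟩
    s + + 1 / suc (2 ℕ.* (2 ^ n ℕ.+ K))
                                 ≤⟨ refine-down K (2 ^ n) ⟩
    logSum a (2 ^ n) + + 1 / suc (2 ^ suc n)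
                                 ≤⟨ ℚ.+-monoʳ-≤ (logSum a (2 ^ n))
                                      (frac-≤ 1 (suc (2 ^ suc n)) 1 (2 ^ suc n) {{_}} {{ℕ.m^n≢0 2 (suc n)}}
                                        (ℕ.*-monoʳ-≤ 1 (ℕ.n≤1+n (2 ^ suc n)))) ⟩
    logSum a (2 ^ n) + 1 /2^ suc n ∎
    where
    open ℚ.≤-Reasoning
    K = (a ∸ 1) ℕ.* 2 ^ n
    s = ∑ (2 ℕ.* K) (f (2 ^ suc n))

module Submission where

-- Write m = d - 1 and let n_s(c) be the number of a in [s, s + K) for which
-- all (c_i + a t_i) mod p lie in [s, s + K), for c in Z_p^m. Over all c these
-- numbers sum to K^d. If h_p(t) ≥ 2K, then n_0(c) n_K(c) = 0 for every c, since
-- the difference of two points counted would be a multiple of (t, 1) with all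
-- residues in [1, 2K - 1]; so n_0 + n_K has second moment Σ_c (n_0² + n_K²),
-- twice as large as the one Cauchy-Schwarz forces for a general t. On average
-- over t, however, Σ_c n_s(c)² is at most K^(2d) / p^m + K^d, because for a ≠ b
-- the pair (c_i + a t_i, c_i + b t_i) is uniform. Hence h_p(t) ≥ 2K has
-- probability at most p^m / K^d. Summing over K = 2^j K₀ with K₀ ≈ p^(m/d)
-- bounds the mean by 20 p^(m/d), and log p ≥ 1/2.

open import Defs
open import Data.Nat
  using (ℕ; zero; suc; _+_; _*_; _^_; _∸_; _≤_; _<_; _>_; z≤n; s≤s; NonZero; >-nonZero; >-nonZero⁻¹;
         NonTrivial; nonTrivial⇒≢1; nonTrivial⇒nonZero; nonTrivial⇒n>1)
open import Data.Nat.Primality using (Prime; prime⇒nonTrivial)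
open import Data.Product using (Σ-syntax; _×_; _,_; proj₁; proj₂)
open import Data.Nat.Properties
open import Data.Nat.DivMod
  using (_%_; m≡m%n+[m/n]*n; [m+kn]%n≡m%n; m<n⇒m%n≡m; m%n<n; m%n≤m; m%n%n≡m%n;
         m≤n⇒[n∸m]%m≡n%m; %-distribˡ-+)
import Data.Nat.DivMod as ℕ
open import Data.Nat.Coprimality using (Coprime; coprime-Bézout; prime⇒coprime; 1-coprimeTo)
import Data.Nat.Coprimality as Coprime
open import Data.Nat.GCD using (module Bézout)
open import Data.Nat.ListAction using (sum)
open import Data.Nat.ListAction.Properties using (sum-++)
open import Data.Nat.Tactic.RingSolver using (solve-∀)
import Data.Integer.Base as ℤ
import Data.Integer.Properties as ℤ
open import Data.Rational.Base as ℚ using (ℚ; 0ℚ; ½; _/_)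
import Data.Rational.Properties as ℚ
open import Data.Rational.Unnormalised.Base using (mkℚᵘ)
import Data.Rational.Unnormalised.Properties as ℚᵘ
open import Data.Fin.Base using (Fin; toℕ; fromℕ<; zero; suc)
open import Data.Fin.Properties using (toℕ<n; toℕ-injective; toℕ-fromℕ<)
open import Data.Fin.Permutation using (Permutation′; permutation; _⟨$⟩ʳ_)
open import Data.List.Base using (List; []; _∷_; map; length; allFin; tabulate; cartesianProductWith)
open import Data.List.Properties using (length-tabulate; map-tabulate; map-++; map-∘)
open import Data.List.Extrema.Nat using (min≤xs; max<v⁺)
open import Data.List.Relation.Unary.All as All using (All; []; _∷_)
open import Data.List.Membership.Propositional.Properties using (∈-map⁺; ∈-upTo⁺)
open import Data.Vec.Base as Vec using (Vec; []; _∷_; lookup)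
open import Data.Sum.Base using (inj₁; inj₂)
open import Algebra.Properties.CommutativeMonoid.Sum +-0-commutativeMonoid
  using (sum-permute) renaming (sum to ∑ᶠ)
open import Function.Base using (_∘_; id)
open import Relation.Binary.Definitions using (tri<; tri≈; tri>)
open import Relation.Nullary using (yes; no; contradiction)
open import Relation.Binary.PropositionalEquality

-- Finite sums over lists and the Cauchy-Schwarz inequality.

sumOver : ∀ {A : Set} → List A → (A → ℕ) → ℕ
sumOver xs f = sum (map f xs)

infix 5 sumOver
syntax sumOver xs (λ x → e) = ∑[ x ← xs ] e

module _ {A : Set} where

  ∑-cong : ∀ {f g : A → ℕ} → (∀ x → f x ≡ g x) → ∀ xs → sumOver xs f ≡ sumOver xs g
  ∑-cong f≡g []       = refl
  ∑-cong f≡g (x ∷ xs) = cong₂ _+_ (f≡g x) (∑-cong f≡g xs)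

  ∑-mono : ∀ {f g : A → ℕ} → (∀ x → f x ≤ g x) → ∀ xs → sumOver xs f ≤ sumOver xs g
  ∑-mono f≤g []       = z≤n
  ∑-mono f≤g (x ∷ xs) = +-mono-≤ (f≤g x) (∑-mono f≤g xs)

  ∑-+ : ∀ (f g : A → ℕ) xs → (∑[ x ← xs ] (f x + g x)) ≡ sumOver xs f + sumOver xs g
  ∑-+ f g []       = refl
  ∑-+ f g (x ∷ xs) = trans (cong (f x + g x +_) (∑-+ f g xs)) (lem (f x) (g x) _ _)
    where
    lem : ∀ a b c d → a + b + (c + d) ≡ a + c + (b + d)
    lem = solve-∀

  ∑-*ˡ : ∀ k (f : A → ℕ) xs → (∑[ x ← xs ] (k * f x)) ≡ k * sumOver xs f
  ∑-*ˡ k f []       = sym (*-zeroʳ k)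
  ∑-*ˡ k f (x ∷ xs) = trans (cong (k * f x +_) (∑-*ˡ k f xs)) (sym (*-distribˡ-+ k (f x) _))

  ∑-*ʳ : ∀ k (f : A → ℕ) xs → (∑[ x ← xs ] (f x * k)) ≡ sumOver xs f * k
  ∑-*ʳ k f xs = trans (∑-cong (λ x → *-comm (f x) k) xs) (trans (∑-*ˡ k f xs) (*-comm k _))

  ∑-const : ∀ k (xs : List A) → (∑[ x ← xs ] k) ≡ length xs * k
  ∑-const k []       = refl
  ∑-const k (x ∷ xs) = cong (k +_) (∑-const k xs)

  ∑-≡0 : ∀ {f : A → ℕ} → (∀ x → f x ≡ 0) → ∀ xs → sumOver xs f ≡ 0
  ∑-≡0 f≡0 xs = trans (∑-cong f≡0 xs) (trans (∑-const 0 xs) (*-zeroʳ (length xs)))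

  -- Termwise 2uv ≤ u² + v². It absorbs the cross term when the induction in `cauchy-schwarz`
  -- expands the square of head plus tail.
  2*∑≤ : ∀ u (f : A → ℕ) xs → 2 * (u * sumOver xs f) ≤ length xs * (u * u) + (∑[ x ← xs ] (f x * f x))
  2*∑≤ u f []       = ≤-reflexive (lem u)
    where
    lem : ∀ u → 2 * (u * 0) ≡ 0
    lem = solve-∀
  2*∑≤ u f (x ∷ xs) = begin
    2 * (u * (f x + S))                        ≡⟨ lem₁ u (f x) S ⟩
    2 * (u * f x) + 2 * (u * S)                ≤⟨ +-mono-≤ (am-gm u (f x)) (2*∑≤ u f xs) ⟩
    u * u + f x * f x + (length xs * (u * u) + Q) ≡⟨ lem₂ (u * u) (f x * f x) (length xs * (u * u)) Q ⟩
    u * u + length xs * (u * u) + (f x * f x + Q) ∎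
    where
    open ≤-Reasoning
    S = sumOver xs f
    Q = ∑[ y ← xs ] (f y * f y)
    lem₁ : ∀ u a b → 2 * (u * (a + b)) ≡ 2 * (u * a) + 2 * (u * b)
    lem₁ = solve-∀
    lem₂ : ∀ a b c d → a + b + (c + d) ≡ a + c + (b + d)
    lem₂ = solve-∀
    square : ∀ u k → 2 * (u * (u + k)) + k * k ≡ u * u + (u + k) * (u + k)
    square = solve-∀
    ordered : ∀ {u v} → u ≤ v → 2 * (u * v) ≤ u * u + v * v
    ordered {u} {v} u≤v = subst (λ w → 2 * (u * w) ≤ u * u + w * w) (m+[n∸m]≡n u≤v)
      (≤-trans (m≤m+n _ _) (≤-reflexive (square u (v ∸ u))))
    am-gm : ∀ u v → 2 * (u * v) ≤ u * u + v * v
    am-gm u v with ≤-total u v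
    ... | inj₁ u≤v = ordered u≤v
    ... | inj₂ v≤u = subst₂ _≤_ (cong (2 *_) (*-comm v u)) (+-comm (v * v) (u * u)) (ordered v≤u)

  cauchy-schwarz : ∀ (f : A → ℕ) xs → sumOver xs f * sumOver xs f ≤ length xs * (∑[ x ← xs ] (f x * f x))
  cauchy-schwarz f []       = z≤n
  cauchy-schwarz f (x ∷ xs) = begin
    (u + S) * (u + S)                   ≡⟨ lem₁ u S ⟩
    u * u + 2 * (u * S) + S * S         ≤⟨ +-mono-≤ (+-monoʳ-≤ (u * u) (2*∑≤ u f xs)) (cauchy-schwarz f xs) ⟩
    u * u + (n * (u * u) + Q) + n * Q   ≡⟨ lem₂ n (u * u) Q ⟩
    suc n * (u * u + Q)                 ∎
    where
    open ≤-Reasoning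
    u = f x
    n = length xs
    S = sumOver xs f
    Q = ∑[ y ← xs ] (f y * f y)
    lem₁ : ∀ u s → (u + s) * (u + s) ≡ u * u + 2 * (u * s) + s * s
    lem₁ = solve-∀
    lem₂ : ∀ n u q → u + (n * u + q) + n * q ≡ suc n * (u + q)
    lem₂ = solve-∀

module _ {A B : Set} where

  ∑-swap : ∀ (f : A → B → ℕ) xs ys →
           (∑[ x ← xs ] ∑[ y ← ys ] f x y) ≡ (∑[ y ← ys ] ∑[ x ← xs ] f x y)
  ∑-swap f []       ys = sym (∑-≡0 (λ _ → refl) ys)
  ∑-swap f (x ∷ xs) ys = trans (cong (sumOver ys (f x) +_) (∑-swap f xs ys))
                               (sym (∑-+ (f x) (λ y → ∑[ x ← xs ] f x y) ys))

  ∑-* : ∀ (f : A → ℕ) (g : B → ℕ) xs ys →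
        sumOver xs f * sumOver ys g ≡ (∑[ x ← xs ] ∑[ y ← ys ] (f x * g y))
  ∑-* f g xs ys = trans (sym (∑-*ʳ (sumOver ys g) f xs)) (∑-cong (λ x → sym (∑-*ˡ (f x) g ys)) xs)

∑-cartesianProductWith : ∀ {A B C : Set} (_·_ : A → B → C) (f : C → ℕ) xs ys →
  sumOver (cartesianProductWith _·_ xs ys) f ≡ (∑[ x ← xs ] ∑[ y ← ys ] f (x · y))
∑-cartesianProductWith _·_ f []       ys = refl
∑-cartesianProductWith _·_ f (x ∷ xs) ys = trans (cong sum (map-++ f (map (x ·_) ys) _))
  (trans (sum-++ (map f (map (x ·_) ys)) _)
         (cong₂ _+_ (cong sum (sym (map-∘ ys))) (∑-cartesianProductWith _·_ f xs ys)))

-- Sums over Z_p and Z_p^m.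

∑-allVecs : ∀ p m (f : Vec (Fin p) (suc m) → ℕ) →
  sumOver (allVecs p (suc m)) f ≡ (∑[ x ← allFin p ] ∑[ v ← allVecs p m ] f (x ∷ v))
∑-allVecs p m f = ∑-cartesianProductWith _∷_ f (allFin p) (allVecs p m)

length-allFin : ∀ n → length (allFin n) ≡ n
length-allFin n = length-tabulate id

length-allVecs : ∀ p m → length (allVecs p m) ≡ p ^ m
length-allVecs p zero    = refl
length-allVecs p (suc m) = begin
  length (allVecs p (suc m))                      ≡⟨ ∑-one (allVecs p (suc m)) ⟨
  (∑[ v ← allVecs p (suc m) ] 1)                  ≡⟨ ∑-allVecs p m (λ _ → 1) ⟩
  (∑[ x ← allFin p ] ∑[ v ← allVecs p m ] 1)      ≡⟨ ∑-const _ (allFin p) ⟩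
  length (allFin p) * (∑[ v ← allVecs p m ] 1)    ≡⟨ cong₂ _*_ (length-allFin p) (∑-one (allVecs p m)) ⟩
  p * length (allVecs p m)                        ≡⟨ cong (p *_) (length-allVecs p m) ⟩
  p * p ^ m                                       ∎
  where
  open ≡-Reasoning
  ∑-one : ∀ {A : Set} (xs : List A) → (∑[ x ← xs ] 1) ≡ length xs
  ∑-one xs = trans (∑-const 1 xs) (*-identityʳ (length xs))

∑-tabulate : ∀ {n} (f : Fin n → ℕ) → sum (tabulate f) ≡ ∑ᶠ f
∑-tabulate {zero}  f = refl
∑-tabulate {suc n} f = cong (f zero +_) (∑-tabulate (f ∘ suc))

∑-allFin : ∀ n (f : Fin n → ℕ) → sumOver (allFin n) f ≡ ∑ᶠ f
∑-allFin n f = trans (cong sum (map-tabulate id f)) (∑-tabulate f)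

∑-permute : ∀ {n} (π : Permutation′ n) (f : Fin n → ℕ) →
            (∑[ x ← allFin n ] f (π ⟨$⟩ʳ x)) ≡ sumOver (allFin n) f
∑-permute {n} π f = trans (∑-allFin n _) (trans (sym (sum-permute f π)) (sym (∑-allFin n f)))

-- Indicator functions of intervals.

-- The indicator function of the interval [s, s + K).
window : ℕ → ℕ → ℕ → ℕ
window zero    zero    x       = 0
window zero    (suc K) zero    = 1
window zero    (suc K) (suc x) = window zero K x
window (suc s) K       zero    = 0
window (suc s) K       (suc x) = window s K x

window-idem : ∀ s K x → window s K x * window s K x ≡ window s K x
window-idem zero    zero    x       = refl
window-idem zero    (suc K) zero    = refl
window-idem zero    (suc K) (suc x) = window-idem zero K x
window-idem (suc s) K       zero    = refl
window-idem (suc s) K       (suc x) = window-idem s K x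

window≢0 : ∀ s K x → window s K x ≢ 0 → s ≤ x × x < s + K
window≢0 zero    zero    x       w≢0 = contradiction refl w≢0
window≢0 zero    (suc K) zero    w≢0 = z≤n , s≤s z≤n
window≢0 zero    (suc K) (suc x) w≢0 = z≤n , s≤s (proj₂ (window≢0 zero K x w≢0))
window≢0 (suc s) K       zero    w≢0 = contradiction refl w≢0
window≢0 (suc s) K       (suc x) w≢0 with window≢0 s K x w≢0
... | s≤x , x<s+K = s≤s s≤x , s≤s x<s+K

window-self : ∀ s → window s 1 s ≡ 1
window-self zero    = refl
window-self (suc s) = window-self s

∑-window : ∀ s K n → s + K ≤ n → (∑[ x ← allFin n ] window s K (toℕ x)) ≡ K
∑-window s K n s+K≤n = trans (∑-allFin n _) (go s K n s+K≤n)
  where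
  ∑ᶠ-0 : ∀ n → ∑ᶠ {n} (λ _ → 0) ≡ 0
  ∑ᶠ-0 zero    = refl
  ∑ᶠ-0 (suc n) = ∑ᶠ-0 n
  go : ∀ s K n → s + K ≤ n → ∑ᶠ {n} (λ x → window s K (toℕ x)) ≡ K
  go zero    zero    n       _         = ∑ᶠ-0 n
  go zero    (suc K) (suc n) (s≤s le)  = cong suc (go zero K n le)
  go (suc s) K       (suc n) (s≤s le)  = go s K n le

-- Affine bijections of Z_p.

module _ (p : ℕ) .{{_ : NonZero p}} .{{_ : NonTrivial p}} where

  %-absorb : ∀ e x y → (x + e * (y % p)) % p ≡ (x + e * y) % p
  %-absorb e x y = sym (begin
    (x + e * y) % p                           ≡⟨ cong (λ z → (x + e * z) % p) (m≡m%n+[m/n]*n y p) ⟩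
    (x + e * (y % p + y ℕ./ p * p)) % p         ≡⟨ cong (_% p) (lem x e (y % p) (y ℕ./ p) p) ⟩
    (x + e * (y % p) + e * (y ℕ./ p) * p) % p   ≡⟨ [m+kn]%n≡m%n (x + e * (y % p)) (e * (y ℕ./ p)) p ⟩
    (x + e * (y % p)) % p                     ∎)
    where
    open ≡-Reasoning
    lem : ∀ x e r q p → x + e * (r + q * p) ≡ x + e * r + e * q * p
    lem = solve-∀

  -- Bézout over ℕ has two forms. If x e = 1 + y p, then x is the inverse. If 1 + x e = y p, then x
  -- e ≡ -1, so (x e)² ≡ 1 and x (e x) is the inverse; there x e = 0 would force y p = 1.
  inverse : ∀ e → Coprime e p → Σ[ e′ ∈ ℕ ] Σ[ k ∈ ℕ ] e * e′ ≡ 1 + k * p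
  inverse e e⊥p with coprime-Bézout e⊥p
  ... | Bézout.+- x y eq = x , y , trans (*-comm e x) (sym eq)
  ... | Bézout.-+ x y eq with x * e in xe≡z
  ...   | zero  = contradiction (m*n≡1⇒n≡1 y p (sym eq)) nonTrivial⇒≢1
  ...   | suc w = x * (e * x) , w * y , (begin
    e * (x * (e * x))    ≡⟨ lem₁ e x ⟩
    x * e * (x * e)      ≡⟨ cong₂ _*_ xe≡z xe≡z ⟩
    suc w * suc w        ≡⟨ lem₂ w ⟩
    1 + w * (1 + suc w)  ≡⟨ cong (λ z → 1 + w * z) eq ⟩
    1 + w * (y * p)      ≡⟨ cong (1 +_) (*-assoc w y p) ⟨
    1 + w * y * p        ∎)
    where
    open ≡-Reasoning
    lem₁ : ∀ e x → e * (x * (e * x)) ≡ x * e * (x * e)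
    lem₁ = solve-∀
    lem₂ : ∀ w → suc w * suc w ≡ 1 + w * (1 + suc w)
    lem₂ = solve-∀

  toℕ% : ∀ (x : Fin p) → toℕ x % p ≡ toℕ x
  toℕ% x = m<n⇒m%n≡m (toℕ<n x)

  affine : ∀ e c → Coprime e p → Permutation′ p
  affine e c e⊥p = permutation to from to∘from from∘to
    where
    e′ = proj₁ (inverse e e⊥p)
    k  = proj₁ (proj₂ (inverse e e⊥p))
    ee′ : e * e′ ≡ 1 + k * p
    ee′ = proj₂ (proj₂ (inverse e e⊥p))
    -- A stand-in for -c: c + (p - 1) c is a multiple of p. The inverse map is y ↦ e′ (c′ + y).
    c′ = (p ∸ 1) * c
    to from : Fin p → Fin p
    to x   = fromℕ< (m%n<n (c + e * toℕ x) p)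
    from y = fromℕ< (m%n<n (e′ * c′ + e′ * toℕ y) p)
    to∘from : ∀ y → to (from y) ≡ y
    to∘from y = toℕ-injective (begin
      toℕ (to (from y))                               ≡⟨ toℕ-fromℕ< _ ⟩
      (c + e * toℕ (from y)) % p                      ≡⟨ cong (λ z → (c + e * z) % p) (toℕ-fromℕ< _) ⟩
      (c + e * ((e′ * c′ + e′ * toℕ y) % p)) % p      ≡⟨ %-absorb e c _ ⟩
      (c + e * (e′ * c′ + e′ * toℕ y)) % p            ≡⟨ cong (_% p) (lem₁ c e e′ c′ (toℕ y)) ⟩
      (c + e * e′ * (c′ + toℕ y)) % p                 ≡⟨ cong (λ z → (c + z * (c′ + toℕ y)) % p) ee′ ⟩
      (c + (1 + k * p) * (c′ + toℕ y)) % p            ≡⟨ cong (_% p) (lem₂ c k p (p ∸ 1) (toℕ y)) ⟩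
      (toℕ y + (1 + (p ∸ 1)) * c + k * (c′ + toℕ y) * p) % p
        ≡⟨ cong (λ z → (toℕ y + z * c + k * (c′ + toℕ y) * p) % p) (suc-pred p) ⟩
      (toℕ y + p * c + k * (c′ + toℕ y) * p) % p      ≡⟨ [m+kn]%n≡m%n _ (k * (c′ + toℕ y)) p ⟩
      (toℕ y + p * c) % p                             ≡⟨ cong (λ z → (toℕ y + z) % p) (*-comm p c) ⟩
      (toℕ y + c * p) % p                             ≡⟨ [m+kn]%n≡m%n (toℕ y) c p ⟩
      toℕ y % p                                       ≡⟨ toℕ% y ⟩
      toℕ y                                           ∎)
      where
      open ≡-Reasoning
      lem₁ : ∀ c e e′ c′ y → c + e * (e′ * c′ + e′ * y) ≡ c + e * e′ * (c′ + y)
      lem₁ = solve-∀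
      lem₂ : ∀ c k p q y → c + (1 + k * p) * (q * c + y) ≡ y + (1 + q) * c + k * (q * c + y) * p
      lem₂ = solve-∀
    from∘to : ∀ x → from (to x) ≡ x
    from∘to x = toℕ-injective (begin
      toℕ (from (to x))                               ≡⟨ toℕ-fromℕ< _ ⟩
      (e′ * c′ + e′ * toℕ (to x)) % p                 ≡⟨ cong (λ z → (e′ * c′ + e′ * z) % p) (toℕ-fromℕ< _) ⟩
      (e′ * c′ + e′ * ((c + e * toℕ x) % p)) % p      ≡⟨ %-absorb e′ (e′ * c′) _ ⟩
      (e′ * c′ + e′ * (c + e * toℕ x)) % p            ≡⟨ cong (_% p) (lem₁ e e′ (p ∸ 1) c (toℕ x)) ⟩
      (e * e′ * toℕ x + (1 + (p ∸ 1)) * (e′ * c)) % p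
        ≡⟨ cong₂ (λ u v → (u * toℕ x + v * (e′ * c)) % p) ee′ (suc-pred p) ⟩
      ((1 + k * p) * toℕ x + p * (e′ * c)) % p        ≡⟨ cong (_% p) (lem₂ k p (toℕ x) (e′ * c)) ⟩
      (toℕ x + (k * toℕ x + e′ * c) * p) % p          ≡⟨ [m+kn]%n≡m%n (toℕ x) (k * toℕ x + e′ * c) p ⟩
      toℕ x % p                                       ≡⟨ toℕ% x ⟩
      toℕ x                                           ∎)
      where
      open ≡-Reasoning
      lem₁ : ∀ e e′ q c x → e′ * (q * c) + e′ * (c + e * x) ≡ e * e′ * x + (1 + q) * (e′ * c)
      lem₁ = solve-∀
      lem₂ : ∀ k p x z → (1 + k * p) * x + p * z ≡ x + (k * x + z) * p
      lem₂ = solve-∀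

  -- Reindexing along the bijection `affine`. Periodicity makes `G` a function on Z_p, so its
  -- arguments can be left unreduced. The case e = 1 gives translations.
  ∑-affine : ∀ e c → Coprime e p → ∀ (G : ℕ → ℕ) → (∀ x → G (x % p) ≡ G x) →
             (∑[ x ← allFin p ] G (c + e * toℕ x)) ≡ (∑[ x ← allFin p ] G (toℕ x))
  ∑-affine e c e⊥p G periodic = trans
    (∑-cong (λ x → trans (sym (periodic _)) (cong G (sym (toℕ-fromℕ< _)))) (allFin p))
    (∑-permute (affine e c e⊥p) (G ∘ toℕ))


-- First and second moments of the number of points in a box.

∑-swap₂ : ∀ {A B C : Set} (f : A → B → C → ℕ) xs ys zs →
  (∑[ x ← xs ] ∑[ y ← ys ] ∑[ z ← zs ] f x y z) ≡ (∑[ z ← zs ] ∑[ x ← xs ] ∑[ y ← ys ] f x y z)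
∑-swap₂ f xs ys zs = trans (∑-cong (λ x → ∑-swap (f x) ys zs) xs)
                           (∑-swap (λ x z → ∑[ y ← ys ] f x y z) xs zs)

module _ (p : ℕ) .{{_ : NonZero p}} (s K : ℕ) where

  -- A product over the coordinates, so that sums over `t` and `c` factor. The last coordinate `a`
  -- is not tested here; `count` draws it from [s, s + K).
  cell : ∀ {m} → Vec (Fin p) m → Vec (Fin p) m → ℕ → ℕ
  cell []      []      a = 1
  cell (x ∷ t) (y ∷ c) a = window s K ((a * toℕ x + toℕ y) % p) * cell t c a

  -- The number of points of the box [s, s + K)^(m + 1) on the translate by
  -- (0, c) of the line spanned by (1, t).
  count : ∀ {m} → Vec (Fin p) m → Vec (Fin p) m → ℕ
  count t c = ∑[ a ← allFin K ] cell t c (s + toℕ a)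

module _ (p : ℕ) .{{_ : NonZero p}} (prime : Prime p) (s K : ℕ) (s+K≤p : s + K ≤ p) where

  private
    instance
      p>1 : NonTrivial p
      p>1 = prime⇒nonTrivial prime

    Z : List (Fin p)
    Z = allFin p

    V : ∀ m → List (Vec (Fin p) m)
    V = allVecs p

    g : ℕ → ℕ
    g x = window s K (x % p)

    periodic : ∀ x → g (x % p) ≡ g x
    periodic x = cong (window s K) (m%n%n≡m%n x p)

    ∑-g : (∑[ x ← Z ] g (toℕ x)) ≡ K
    ∑-g = trans (∑-cong (λ x → cong (window s K) (toℕ% p x)) Z) (∑-window s K p s+K≤p)

    ∑-shift : ∀ c (G : ℕ → ℕ) → (∀ x → G (x % p) ≡ G x) →
              (∑[ x ← Z ] G (c + toℕ x)) ≡ (∑[ x ← Z ] G (toℕ x))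
    ∑-shift c G per = trans
      (∑-cong (λ x → cong (λ z → G (c + z)) (sym (*-identityˡ (toℕ x)))) Z)
      (∑-affine p 1 c (1-coprimeTo p) G per)

    -- One coordinate's share of the second moment: x plays t_i, y plays c_i, and both parameters a
    -- and b must hit the window.
    pairs : ℕ → ℕ → ℕ
    pairs a b = ∑[ x ← Z ] ∑[ y ← Z ] (g (a * toℕ x + toℕ y) * g (b * toℕ x + toℕ y))

    pairs-diagonal : ∀ a → pairs a a ≡ p * K
    pairs-diagonal a = begin
      pairs a a
        ≡⟨ ∑-cong (λ x → ∑-cong (λ y → window-idem s K _) Z) Z ⟩
      (∑[ x ← Z ] ∑[ y ← Z ] g (a * toℕ x + toℕ y))
        ≡⟨ ∑-cong (λ x → trans (∑-shift (a * toℕ x) g periodic) ∑-g) Z ⟩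
      (∑[ x ← Z ] K)                                 ≡⟨ ∑-const K Z ⟩
      length Z * K                                   ≡⟨ cong (_* K) (length-allFin p) ⟩
      p * K                                          ∎
      where open ≡-Reasoning

    -- For fixed x, translating y by a x turns the two arguments into y and y + e x. For fixed y,
    -- the map x ↦ y + e x is then a bijection, as 0 < e < p with p prime. So the two residues range
    -- independently over Z_p.
    pairs-< : ∀ a e → .{{NonZero e}} → e < p → pairs a (a + e) ≡ K * K
    pairs-< a e e<p = begin
      pairs a (a + e)
        ≡⟨ ∑-cong (λ x → trans
             (∑-cong (λ y → cong (λ z → g (a * toℕ x + toℕ y) * g z) (lem a e (toℕ x) (toℕ y))) Z)
             (∑-shift (a * toℕ x) (λ z → g z * g (z + e * toℕ x)) (λ z → cong₂ _*_ (periodic z)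
               (cong (window s K) (%-absorbˡ z (e * toℕ x)))))) Z ⟩
      (∑[ x ← Z ] ∑[ y ← Z ] (g (toℕ y) * g (toℕ y + e * toℕ x)))
        ≡⟨ ∑-swap (λ x y → g (toℕ y) * g (toℕ y + e * toℕ x)) Z Z ⟩
      (∑[ y ← Z ] ∑[ x ← Z ] (g (toℕ y) * g (toℕ y + e * toℕ x)))
        ≡⟨ ∑-cong (λ y → trans (∑-*ˡ (g (toℕ y)) (λ x → g (toℕ y + e * toℕ x)) Z)
             (cong (g (toℕ y) *_) (trans (∑-affine p e (toℕ y)
               (Coprime.sym (prime⇒coprime prime e<p)) g periodic) ∑-g))) Z ⟩
      (∑[ y ← Z ] (g (toℕ y) * K))
        ≡⟨ ∑-*ʳ K (g ∘ toℕ) Z ⟩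
      (∑[ y ← Z ] g (toℕ y)) * K
        ≡⟨ cong (_* K) ∑-g ⟩
      K * K ∎
      where
      open ≡-Reasoning
      lem : ∀ a e x y → (a + e) * x + y ≡ a * x + y + e * x
      lem = solve-∀
      %-absorbˡ : ∀ z w → (z % p + w) % p ≡ (z + w) % p
      %-absorbˡ z w = begin
        (z % p + w) % p         ≡⟨ cong (_% p) (lem′ (z % p) w) ⟩
        (w + 1 * (z % p)) % p   ≡⟨ %-absorb p 1 w z ⟩
        (w + 1 * z) % p         ≡⟨ cong (_% p) (lem′ z w) ⟨
        (z + w) % p             ∎
        where
        lem′ : ∀ z w → z + w ≡ w + 1 * z
        lem′ = solve-∀

    pairs-sym : ∀ a b → pairs a b ≡ pairs b a
    pairs-sym a b = ∑-cong (λ x → ∑-cong (λ y → *-comm (g (a * toℕ x + toℕ y)) _) Z) Z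

    pairs-ordered : ∀ {a b} → a < b → b < a + p → pairs a b ≡ K * K
    pairs-ordered {a} {b} a<b b<a+p = trans (cong (pairs a) (sym (m+[n∸m]≡n (<⇒≤ a<b))))
      (pairs-< a (b ∸ a) {{>-nonZero (m<n⇒0<n∸m a<b)}} (m<n+o⇒m∸n<o b a {{nonTrivial⇒nonZero p}} b<a+p))

    ∑-cell : ∀ {m} (t : Vec (Fin p) m) a → (∑[ c ← V m ] cell p s K t c a) ≡ K ^ m
    ∑-cell []      a = refl
    ∑-cell {suc m} (x ∷ t) a = begin
      (∑[ c ← V (suc m) ] cell p s K (x ∷ t) c a)
        ≡⟨ ∑-allVecs p m _ ⟩
      (∑[ y ← Z ] ∑[ c ← V m ] (g (a * toℕ x + toℕ y) * cell p s K t c a))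
        ≡⟨ ∑-* (λ y → g (a * toℕ x + toℕ y)) (λ c → cell p s K t c a) Z (V m) ⟨
      (∑[ y ← Z ] g (a * toℕ x + toℕ y)) * (∑[ c ← V m ] cell p s K t c a)
        ≡⟨ cong₂ _*_ (trans (∑-shift (a * toℕ x) g periodic) ∑-g) (∑-cell t a) ⟩
      K * K ^ m ∎
      where open ≡-Reasoning

    -- The summand is a product of factors, each depending only on its own pair (t_i, c_i), so the
    -- double sum is an m-th power.
    ∑-cell-pairs : ∀ m a b →
      (∑[ t ← V m ] ∑[ c ← V m ] (cell p s K t c a * cell p s K t c b)) ≡ pairs a b ^ m
    ∑-cell-pairs zero    a b = refl
    ∑-cell-pairs (suc m) a b = begin
      (∑[ t ← V (suc m) ] ∑[ c ← V (suc m) ] (cell p s K t c a * cell p s K t c b))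
        ≡⟨ ∑-allVecs p m _ ⟩
      (∑[ x ← Z ] ∑[ t ← V m ] ∑[ c ← V (suc m) ] (cell p s K (x ∷ t) c a * cell p s K (x ∷ t) c b))
        ≡⟨ ∑-cong (λ x → ∑-cong (λ t → begin
             (∑[ c ← V (suc m) ] (cell p s K (x ∷ t) c a * cell p s K (x ∷ t) c b))
               ≡⟨ ∑-allVecs p m _ ⟩
             (∑[ y ← Z ] ∑[ c ← V m ] (cell p s K (x ∷ t) (y ∷ c) a * cell p s K (x ∷ t) (y ∷ c) b))
               ≡⟨ ∑-cong (λ y → ∑-cong (λ c → lem (g (a * toℕ x + toℕ y)) (cell p s K t c a)
                    (g (b * toℕ x + toℕ y)) (cell p s K t c b)) (V m)) Z ⟩
             (∑[ y ← Z ] ∑[ c ← V m ] (Φ x y * Ψ t c))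
               ≡⟨ ∑-* (Φ x) (Ψ t) Z (V m) ⟨
             sumOver Z (Φ x) * sumOver (V m) (Ψ t) ∎) (V m)) Z ⟩
      (∑[ x ← Z ] ∑[ t ← V m ] (sumOver Z (Φ x) * sumOver (V m) (Ψ t)))
        ≡⟨ ∑-* (λ x → sumOver Z (Φ x)) (λ t → sumOver (V m) (Ψ t)) Z (V m) ⟨
      pairs a b * (∑[ t ← V m ] sumOver (V m) (Ψ t))
        ≡⟨ cong (pairs a b *_) (∑-cell-pairs m a b) ⟩
      pairs a b * pairs a b ^ m ∎
      where
      open ≡-Reasoning
      Φ : Fin p → Fin p → ℕ
      Φ x y = g (a * toℕ x + toℕ y) * g (b * toℕ x + toℕ y)
      Ψ : Vec (Fin p) m → Vec (Fin p) m → ℕ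
      Ψ t c = cell p s K t c a * cell p s K t c b
      lem : ∀ a b c d → a * b * (c * d) ≡ a * c * (b * d)
      lem = solve-∀

    off-diagonal : ∀ (a b : Fin K) → toℕ a < toℕ b → pairs (s + toℕ a) (s + toℕ b) ≡ K * K
    off-diagonal a b a<b = pairs-ordered (+-monoʳ-< s a<b)
      (<-≤-trans (+-monoʳ-< s (toℕ<n b)) (≤-trans s+K≤p (m≤n+m p (s + toℕ a))))

    -- `window (toℕ a) 1` serves as the Kronecker delta at a. The first term is kept on the diagonal
    -- too, which gives one formula to sum over all a and b.
    pairs^m≤ : ∀ m (a b : Fin K) → pairs (s + toℕ a) (s + toℕ b) ^ m ≤
               (K * K) ^ m + window (toℕ a) 1 (toℕ b) * (p * K) ^ m
    pairs^m≤ m a b with <-cmp (toℕ a) (toℕ b)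
    ... | tri< a<b _ _ = ≤-trans (≤-reflexive (cong (_^ m) (off-diagonal a b a<b))) (m≤m+n _ _)
    ... | tri> _ _ b<a = ≤-trans (≤-reflexive (cong (_^ m)
      (trans (pairs-sym (s + toℕ a) (s + toℕ b)) (off-diagonal b a b<a)))) (m≤m+n _ _)
    ... | tri≈ _ a≡b _ = ≤-trans (≤-reflexive (begin
      pairs (s + toℕ a) (s + toℕ b) ^ m        ≡⟨ cong (λ z → pairs (s + toℕ a) (s + z) ^ m) a≡b ⟨
      pairs (s + toℕ a) (s + toℕ a) ^ m        ≡⟨ cong (_^ m) (pairs-diagonal (s + toℕ a)) ⟩
      (p * K) ^ m                              ≡⟨ *-identityˡ ((p * K) ^ m) ⟨
      1 * (p * K) ^ m                          ≡⟨ cong (_* (p * K) ^ m) (window-self (toℕ a)) ⟨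
      window (toℕ a) 1 (toℕ a) * (p * K) ^ m   ≡⟨ cong (λ z → window (toℕ a) 1 z * (p * K) ^ m) a≡b ⟩
      window (toℕ a) 1 (toℕ b) * (p * K) ^ m   ∎)) (m≤n+m _ _)
      where open ≡-Reasoning

  -- Each of the K values of a contributes K^m. The total is the same for every `t`, so
  -- Cauchy-Schwarz bounds the second moment below for each `t` separately.
  ∑-count : ∀ {m} (t : Vec (Fin p) m) → (∑[ c ← allVecs p m ] count p s K t c) ≡ K * K ^ m
  ∑-count {m} t = begin
    (∑[ c ← V m ] count p s K t c)
      ≡⟨ ∑-swap (λ c a → cell p s K t c (s + toℕ a)) (V m) (allFin K) ⟩
    (∑[ a ← allFin K ] ∑[ c ← V m ] cell p s K t c (s + toℕ a))
      ≡⟨ ∑-cong (λ a → ∑-cell t (s + toℕ a)) (allFin K) ⟩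
    (∑[ a ← allFin K ] K ^ m)
      ≡⟨ ∑-const (K ^ m) (allFin K) ⟩
    length (allFin K) * K ^ m
      ≡⟨ cong (_* K ^ m) (length-allFin K) ⟩
    K * K ^ m ∎
    where open ≡-Reasoning

  -- Expand the square over pairs (a, b) and sum over `t` and `c` first. All K² pairs are charged
  -- `(K * K) ^ m`, and the K diagonal ones `(p * K) ^ m` on top.
  ∑-count²-≤ : ∀ m → (∑[ t ← allVecs p m ] ∑[ c ← allVecs p m ] (count p s K t c * count p s K t c))
                   ≤ K * (K * (K * K) ^ m + (p * K) ^ m)
  ∑-count²-≤ m = begin
    (∑[ t ← V m ] ∑[ c ← V m ] (count p s K t c * count p s K t c))
      ≡⟨ ∑-cong (λ t → ∑-cong (λ c → ∑-* (C t c) (C t c) (allFin K) (allFin K)) (V m)) (V m) ⟩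
    (∑[ t ← V m ] ∑[ c ← V m ] ∑[ a ← allFin K ] ∑[ b ← allFin K ] (C t c a * C t c b))
      ≡⟨ ∑-swap₂ (λ t c a → ∑[ b ← allFin K ] (C t c a * C t c b)) (V m) (V m) (allFin K) ⟩
    (∑[ a ← allFin K ] ∑[ t ← V m ] ∑[ c ← V m ] ∑[ b ← allFin K ] (C t c a * C t c b))
      ≡⟨ ∑-cong (λ a → ∑-swap₂ (λ t c b → C t c a * C t c b) (V m) (V m) (allFin K)) (allFin K) ⟩
    (∑[ a ← allFin K ] ∑[ b ← allFin K ] ∑[ t ← V m ] ∑[ c ← V m ] (C t c a * C t c b))
      ≤⟨ ∑-mono (λ a → ∑-mono (λ b → ≤-trans
           (≤-reflexive (∑-cell-pairs m (s + toℕ a) (s + toℕ b))) (pairs^m≤ m a b)) (allFin K)) (allFin K) ⟩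
    (∑[ a ← allFin K ] ∑[ b ← allFin K ] (N + window (toℕ a) 1 (toℕ b) * D))
      ≡⟨ ∑-cong (λ a → begin-equality
           (∑[ b ← allFin K ] (N + window (toℕ a) 1 (toℕ b) * D))
             ≡⟨ ∑-+ (λ _ → N) (λ b → window (toℕ a) 1 (toℕ b) * D) (allFin K) ⟩
           (∑[ b ← allFin K ] N) + (∑[ b ← allFin K ] (window (toℕ a) 1 (toℕ b) * D))
             ≡⟨ cong₂ _+_ (∑-const N (allFin K)) (∑-*ʳ D (λ b → window (toℕ a) 1 (toℕ b)) (allFin K)) ⟩
           length (allFin K) * N + (∑[ b ← allFin K ] window (toℕ a) 1 (toℕ b)) * D
             ≡⟨ cong₂ (λ u v → u * N + v * D) (length-allFin K)
                  (∑-window (toℕ a) 1 K (subst (_≤ K) (+-comm 1 (toℕ a)) (toℕ<n a))) ⟩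
           K * N + 1 * D
             ≡⟨ cong (K * N +_) (*-identityˡ D) ⟩
           K * N + D ∎) (allFin K) ⟩
    (∑[ a ← allFin K ] (K * N + D))
      ≡⟨ ∑-const (K * N + D) (allFin K) ⟩
    length (allFin K) * (K * N + D)
      ≡⟨ cong (_* (K * N + D)) (length-allFin K) ⟩
    K * (K * N + D) ∎
    where
    open ≤-Reasoning
    N = (K * K) ^ m
    D = (p * K) ^ m
    C : Vec (Fin p) m → Vec (Fin p) m → Fin K → ℕ
    C t c a = cell p s K t c (s + toℕ a)

^-distribʳ-* : ∀ a b k → (a * b) ^ k ≡ a ^ k * b ^ k
^-distribʳ-* a b zero    = refl
^-distribʳ-* a b (suc k) = trans (cong (a * b *_) (^-distribʳ-* a b k)) ([m*n]*[o*p]≡[m*o]*[n*p] a b _ _)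

-- Heights of vectors and points in two adjacent boxes.

atLeast : ℕ → ℕ → ℕ
atLeast zero    n       = 1
atLeast (suc m) zero    = 0
atLeast (suc m) (suc n) = atLeast m n

atLeast-≤ : ∀ {m n} → m ≤ n → atLeast m n ≡ 1
atLeast-≤ z≤n       = refl
atLeast-≤ (s≤s m≤n) = atLeast-≤ m≤n

atLeast-> : ∀ {m n} → n < m → atLeast m n ≡ 0
atLeast-> {suc m} {zero}  _         = refl
atLeast-> {suc m} {suc n} (s≤s n<m) = atLeast-> n<m

h≤height : ∀ {m} p .{{_ : NonZero p}} (t : Vec (Fin p) m) e → 0 < e → e < p → h p t ≤ height p t e
h≤height p t (suc k) _ e<p = All.lookup (min≤xs (height p t 1) _)
  (∈-map⁺ (λ k → height p t (suc k)) (∈-upTo⁺ (∸-monoˡ-≤ 1 e<p)))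

height-< : ∀ {m} p .{{_ : NonZero p}} (t : Vec (Fin p) m) e v → e < v →
           (∀ i → (e * toℕ (lookup t i)) % p < v) → height p t e < v
height-< p t e v e<v residues = max<v⁺ e<v (go t residues)
  where
  go : ∀ {m} (t : Vec (Fin p) m) → (∀ i → (e * toℕ (lookup t i)) % p < v) →
       All (_< v) (Vec.toList (Vec.map (λ x → (e * toℕ x) % p) t))
  go []      r = []
  go (x ∷ t) r = r zero ∷ go t (r ∘ suc)

h<p : ∀ {m} p .{{_ : NonZero p}} → 1 < p → (t : Vec (Fin p) m) → h p t < p
h<p p 1<p t = ≤-<-trans (h≤height p t 1 (s≤s z≤n) 1<p)
  (height-< p t 1 p 1<p (λ i → m%n<n (1 * toℕ (lookup t i)) p))

cell≢0 : ∀ {m} p .{{_ : NonZero p}} s K (t c : Vec (Fin p) m) a → cell p s K t c a ≢ 0 →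
         ∀ i → s ≤ (a * toℕ (lookup t i) + toℕ (lookup c i)) % p ×
               (a * toℕ (lookup t i) + toℕ (lookup c i)) % p < s + K
cell≢0 p s K (x ∷ t) (y ∷ c) a ≢0 zero    = window≢0 s K _ λ w≡0 → ≢0 (cong (_* cell p s K t c a) w≡0)
cell≢0 p s K (x ∷ t) (y ∷ c) a ≢0 (suc i) = cell≢0 p s K t c a
  (λ c≡0 → ≢0 (trans (cong (window s K _ *_) c≡0) (*-zeroʳ (window s K _)))) i

-- Adding the residues of u and w cannot wrap around, since that would give u + w - p < u. Without
-- wrapping, the sum is at least its summand w.
%-difference-< : ∀ p .{{_ : NonZero p}} u w → u % p ≤ (u + w) % p → w % p ≤ (u + w) % p
%-difference-< p u w u≤v = subst (w % p ≤_) (sym (%-distribˡ-+ u w p))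
  (go (u % p) (w % p) (m%n<n u p) (m%n<n w p) (subst (u % p ≤_) (%-distribˡ-+ u w p) u≤v))
  where
  go : ∀ u w → u < p → w < p → u ≤ (u + w) % p → w ≤ (u + w) % p
  go u w u<p w<p u≤v with u + w <? p
  ... | yes u+w<p = subst (w ≤_) (sym (m<n⇒m%n≡m u+w<p)) (m≤n+m w u)
  ... | no  u+w≮p = contradiction u≤v (<⇒≱ (begin-strict
    (u + w) % p      ≡⟨ m≤n⇒[n∸m]%m≡n%m p≤u+w ⟨
    (u + w ∸ p) % p  ≤⟨ m%n≤m (u + w ∸ p) p ⟩
    u + w ∸ p        <⟨ ∸-monoˡ-< (+-monoʳ-< u w<p) p≤u+w ⟩
    u + p ∸ p        ≡⟨ m+n∸n≡m u p ⟩
    u                ∎))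
    where
    open ≤-Reasoning
    p≤u+w = ≮⇒≥ u+w≮p

-- Otherwise e = K + b - a is a multiplier with height below 2K. In every coordinate the first point
-- lies in [0, K) and the second in [K, 2K), so all differences are positive at once and below 2K.
-- The bound 2K < p makes e admissible in the minimum defining `h`.
cells-disjoint : ∀ {m} p .{{_ : NonZero p}} K → K + K < p → (t c : Vec (Fin p) m) →
  K + K ≤ h p t → ∀ {a b} → a < K → b < K → cell p 0 K t c a * cell p K K t c (K + b) ≡ 0
cells-disjoint p K 2K<p t c 2K≤h {a} {b} a<K b<K with cell p 0 K t c a ≟ 0 | cell p K K t c (K + b) ≟ 0
... | yes eq | _ = cong (_* cell p K K t c (K + b)) eq
... | no _ | yes eq = trans (cong (cell p 0 K t c a *_) eq) (*-zeroʳ (cell p 0 K t c a))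
... | no low | no high = contradiction 2K≤h (<⇒≱ (≤-<-trans
      (h≤height p t e (m<n⇒0<n∸m a<K+b) (<-trans e<2K 2K<p))
      (height-< p t e (K + K) e<2K small)))
  where
  e = K + b ∸ a
  a<K+b : a < K + b
  a<K+b = <-≤-trans a<K (m≤m+n K b)
  e<2K : e < K + K
  e<2K = ≤-<-trans (m∸n≤m (K + b) a) (+-monoʳ-< K b<K)
  small : ∀ i → (e * toℕ (lookup t i)) % p < K + K
  small i = ≤-<-trans (%-difference-< p u w (<⇒≤ (<-≤-trans u<K K≤v))) v<2K
    where
    x = toℕ (lookup t i)
    y = toℕ (lookup c i)
    u = a * x + y
    w = e * x
    lem : ∀ a e x y → a * x + y + e * x ≡ (a + e) * x + y
    lem = solve-∀
    u+w : u + w ≡ (K + b) * x + y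
    u+w = trans (lem a e x y) (cong (λ z → z * x + y) (m+[n∸m]≡n (<⇒≤ a<K+b)))
    u<K : u % p < K
    u<K = proj₂ (cell≢0 p 0 K t c a low i)
    K≤v : K ≤ (u + w) % p
    K≤v = subst (λ z → K ≤ z % p) (sym u+w) (proj₁ (cell≢0 p K K t c (K + b) high i))
    v<2K : (u + w) % p < K + K
    v<2K = subst (λ z → z % p < K + K) (sym u+w) (proj₂ (cell≢0 p K K t c (K + b) high i))

counts-disjoint : ∀ {m} p .{{_ : NonZero p}} K → K + K < p → (t : Vec (Fin p) m) →
  K + K ≤ h p t → ∀ c → count p 0 K t c * count p K K t c ≡ 0
counts-disjoint p K 2K<p t 2K≤h c = trans
  (∑-* (λ a → cell p 0 K t c (toℕ a)) (λ b → cell p K K t c (K + toℕ b)) (allFin K) (allFin K))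
  (∑-≡0 (λ a → ∑-≡0 (λ b → cells-disjoint p K 2K<p t c 2K≤h (toℕ<n a) (toℕ<n b)) (allFin K)) (allFin K))

-- The tail of the distribution of h_p.

module _ (p : ℕ) .{{_ : NonZero p}} (prime : Prime p) (m K : ℕ) .{{_ : NonZero K}} (2K<p : K + K < p) where

  private
    V : List (Vec (Fin p) m)
    V = allVecs p m

    -- `P` is the number of translates c, and `X` = K^d is the sum of the counts over them.
    P X : ℕ
    P = p ^ m
    X = K * K ^ m

    K≤p : K ≤ p
    K≤p = ≤-trans (m≤m+n K K) (<⇒≤ 2K<p)

    Q : ℕ → Vec (Fin p) m → ℕ
    Q s t = ∑[ c ← V ] (count p s K t c * count p s K t c)

    bad : Vec (Fin p) m → ℕ
    bad t = atLeast (K + K) (h p t)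

    B : ℕ
    B = ∑[ t ← V ] bad t

    energy-≥ : ∀ s → s + K ≤ p → ∀ t → X * X ≤ P * Q s t
    energy-≥ s s+K≤p t = subst₂ (λ x n → x * x ≤ n * Q s t)
      (∑-count p prime s K s+K≤p t) (length-allVecs p m) (cauchy-schwarz (count p s K t) V)

    -- Cauchy-Schwarz for n₀ + n₁, whose total is 2X. The cross terms vanish by `counts-disjoint`,
    -- so 4X² appears where the two separate applications give 2X².
    energy-bad : ∀ t → K + K ≤ h p t → (X + X) * (X + X) ≤ P * (Q 0 t + Q K t)
    energy-bad t 2K≤h = begin
      (X + X) * (X + X)
        ≡⟨ cong (λ x → x * x) (trans (∑-+ n₀ n₁ V)
             (cong₂ _+_ (∑-count p prime 0 K K≤p t) (∑-count p prime K K (<⇒≤ 2K<p) t))) ⟨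
      sumOver V n * sumOver V n
        ≤⟨ cauchy-schwarz n V ⟩
      length V * (∑[ c ← V ] (n c * n c))
        ≡⟨ cong₂ _*_ (length-allVecs p m) (trans
             (∑-cong (λ c → square (n₀ c) (n₁ c) (counts-disjoint p K 2K<p t 2K≤h c)) V)
             (∑-+ (λ c → n₀ c * n₀ c) (λ c → n₁ c * n₁ c) V)) ⟩
      P * (Q 0 t + Q K t) ∎
      where
      open ≤-Reasoning
      n₀ n₁ n : Vec (Fin p) m → ℕ
      n₀ = count p 0 K t
      n₁ = count p K K t
      n c = n₀ c + n₁ c
      lem : ∀ u v → (u + v) * (u + v) ≡ u * u + v * v + 2 * (u * v)
      lem = solve-∀
      square : ∀ u v → u * v ≡ 0 → (u + v) * (u + v) ≡ u * u + v * v
      square u v uv≡0 = trans (lem u v) (trans (cong (λ z → u * u + v * v + 2 * z) uv≡0) (+-identityʳ _))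

    -- Both cases in one inequality, linear in the indicator `bad`, so that it can be summed over t.
    energy : ∀ t → 2 * (X * X) + 2 * (X * X) * bad t ≤ P * (Q 0 t + Q K t)
    energy t with K + K ≤? h p t
    ... | yes 2K≤h = ≤-trans (≤-reflexive (trans
            (cong (λ z → 2 * (X * X) + 2 * (X * X) * z) (atLeast-≤ 2K≤h)) (lem X))) (energy-bad t 2K≤h)
      where
      lem : ∀ x → 2 * (x * x) + 2 * (x * x) * 1 ≡ (x + x) * (x + x)
      lem = solve-∀
    ... | no 2K≰h = begin
      2 * (X * X) + 2 * (X * X) * bad t   ≡⟨ cong (λ z → 2 * (X * X) + 2 * (X * X) * z) (atLeast-> (≰⇒> 2K≰h)) ⟩
      2 * (X * X) + 2 * (X * X) * 0       ≡⟨ lem X ⟩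
      X * X + X * X                       ≤⟨ +-mono-≤ (energy-≥ 0 K≤p t) (energy-≥ K (<⇒≤ 2K<p) t) ⟩
      P * Q 0 t + P * Q K t               ≡⟨ *-distribˡ-+ P (Q 0 t) (Q K t) ⟨
      P * (Q 0 t + Q K t)                 ∎
      where
      open ≤-Reasoning
      lem : ∀ x → 2 * (x * x) + 2 * (x * x) * 0 ≡ x * x + x * x
      lem = solve-∀

    total-energy : ∀ s → s + K ≤ p → (∑[ t ← V ] Q s t) ≤ X * X + X * P
    total-energy s s+K≤p = ≤-trans (∑-count²-≤ p prime s K s+K≤p m) (≤-reflexive (trans
      (cong₂ (λ u v → K * (K * u + v)) (^-distribʳ-* K K m) (^-distribʳ-* p K m)) (lem K (K ^ m) P)))
      where
      lem : ∀ k x q → k * (k * (x * x) + q * x) ≡ k * x * (k * x) + k * x * q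
      lem = solve-∀

  -- Summing `energy` over t gives 2X²P + 2X²B ≤ P (2X² + 2XP) by the second moment bounds. The main
  -- terms cancel exactly, and dividing by 2X leaves X B ≤ P².
  tail-bound-2K<p : K * K ^ m * (∑[ t ← allVecs p m ] atLeast (K + K) (h p t)) ≤ p ^ m * p ^ m
  tail-bound-2K<p = *-cancelˡ-≤ (2 * X) (+-cancelˡ-≤ (P * (2 * (X * X))) _ _ (begin
    P * (2 * (X * X)) + 2 * X * (X * B)
      ≡⟨ lem₁ P X B ⟩
    P * (2 * (X * X)) + 2 * (X * X) * B
      ≡⟨ cong₂ _+_ (trans (cong (_* (2 * (X * X))) (sym (length-allVecs p m))) (sym (∑-const (2 * (X * X)) V)))
                   (sym (∑-*ˡ (2 * (X * X)) bad V)) ⟩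
    (∑[ t ← V ] (2 * (X * X))) + (∑[ t ← V ] (2 * (X * X) * bad t))
      ≡⟨ ∑-+ (λ _ → 2 * (X * X)) (λ t → 2 * (X * X) * bad t) V ⟨
    (∑[ t ← V ] (2 * (X * X) + 2 * (X * X) * bad t))
      ≤⟨ ∑-mono energy V ⟩
    (∑[ t ← V ] (P * (Q 0 t + Q K t)))
      ≡⟨ trans (∑-*ˡ P (λ t → Q 0 t + Q K t) V) (cong (P *_) (∑-+ (Q 0) (Q K) V)) ⟩
    P * (sumOver V (Q 0) + sumOver V (Q K))
      ≤⟨ *-monoʳ-≤ P (+-mono-≤ (total-energy 0 K≤p) (total-energy K (<⇒≤ 2K<p))) ⟩
    P * (X * X + X * P + (X * X + X * P))
      ≡⟨ lem₂ P X ⟩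
    P * (2 * (X * X)) + 2 * X * (P * P) ∎))
    where
    open ≤-Reasoning
    instance
      K^m≢0 : NonZero (K ^ m)
      K^m≢0 = m^n≢0 K m
      X≢0 : NonZero X
      X≢0 = m*n≢0 K (K ^ m)
      2X≢0 : NonZero (2 * X)
      2X≢0 = m*n≢0 2 X
    lem₁ : ∀ p x b → p * (2 * (x * x)) + 2 * x * (x * b) ≡ p * (2 * (x * x)) + 2 * (x * x) * b
    lem₁ = solve-∀
    lem₂ : ∀ p x → p * (x * x + x * p + (x * x + x * p)) ≡ p * (2 * (x * x)) + 2 * x * (p * p)
    lem₂ = solve-∀

-- In the remaining case 2K ≥ p no vector is bad, because h_p < p.
tail-bound : ∀ p .{{_ : NonZero p}} → Prime p → ∀ m K .{{_ : NonZero K}} →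
  K * K ^ m * (∑[ t ← allVecs p m ] atLeast (K + K) (h p t)) ≤ p ^ m * p ^ m
tail-bound p p-prime m K with K + K <? p
... | yes 2K<p = tail-bound-2K<p p p-prime m K 2K<p
... | no  2K≮p = subst (_≤ p ^ m * p ^ m) (sym (trans
      (cong (K * K ^ m *_) (∑-≡0 (λ t → atLeast-> (<-≤-trans (h<p p 1<p t) (≮⇒≥ 2K≮p))) (allVecs p m)))
      (*-zeroʳ (K * K ^ m)))) z≤n
  where
  1<p : 1 < p
  1<p = nonTrivial⇒n>1 p {{prime⇒nonTrivial p-prime}}

-- Dyadic summation of the tail.

dyadicSum : (ℕ → ℕ) → ℕ → ℕ
dyadicSum f zero    = 0
dyadicSum f (suc J) = dyadicSum f J + 2 ^ J * f J

-- The highest threshold reached is enough: if 2^j A ≤ n < 2^(j+1) A, then the term of j alone, 2 A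
-- 2^j, exceeds n. If no threshold is reached, then n < A.
layer-cake : ∀ A n J → n < 2 ^ J * A → n ≤ A + 2 * A * dyadicSum (λ j → atLeast (2 ^ j * A) n) J
layer-cake A n zero    n<A = ≤-trans (<⇒≤ (subst (n <_) (+-identityʳ A) n<A)) (m≤m+n A _)
layer-cake A n (suc J) n<  with n <? 2 ^ J * A
... | yes n<′ = ≤-trans (layer-cake A n J n<′) (+-monoʳ-≤ A (*-monoʳ-≤ (2 * A) (m≤m+n _ _)))
... | no  n≮  = begin
  n                                    ≤⟨ <⇒≤ n< ⟩
  2 ^ suc J * A                        ≡⟨ lem (2 ^ J) A ⟩
  2 * A * (2 ^ J * 1)                  ≡⟨ cong (λ z → 2 * A * (2 ^ J * z)) (atLeast-≤ (≮⇒≥ n≮)) ⟨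
  2 * A * (2 ^ J * f J)                ≤⟨ *-monoʳ-≤ (2 * A) (m≤n+m _ (dyadicSum f J)) ⟩
  2 * A * dyadicSum f (suc J)          ≤⟨ m≤n+m _ A ⟩
  A + 2 * A * dyadicSum f (suc J)      ∎
  where
  open ≤-Reasoning
  f : ℕ → ℕ
  f j = atLeast (2 ^ j * A) n
  lem : ∀ x a → 2 * x * a ≡ 2 * a * (x * 1)
  lem = solve-∀

∑-dyadicSum : ∀ {A : Set} (f : A → ℕ → ℕ) xs J →
  (∑[ x ← xs ] dyadicSum (f x) J) ≡ dyadicSum (λ j → ∑[ x ← xs ] f x j) J
∑-dyadicSum f xs zero    = ∑-≡0 (λ _ → refl) xs
∑-dyadicSum f xs (suc J) = trans (∑-+ (λ x → dyadicSum (f x) J) (λ x → 2 ^ J * f x J) xs)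
  (cong₂ _+_ (∑-dyadicSum f xs J) (∑-*ˡ (2 ^ J) (λ x → f x J) xs))

-- Since f j ≤ P / 4^j, the weighted terms are at most P / 2^j, a geometric series.
dyadicSum-≤ : ∀ f P → (∀ j → 2 ^ j * (2 ^ j * f j) ≤ P) → ∀ J → dyadicSum f J ≤ 2 * P
dyadicSum-≤ f P decay J = *-cancelˡ-≤ (2 ^ J) {{m^n≢0 2 J}} (m+n≤o⇒m≤o _ (go J))
  where
  -- The partial sum is at most 2P (1 - 2^(-J)), with denominators cleared; the extra `2 * P` is the
  -- slack that closes the induction.
  go : ∀ J → 2 ^ J * dyadicSum f J + 2 * P ≤ 2 ^ J * (2 * P)
  go zero    = ≤-reflexive (sym (*-identityˡ (2 * P)))
  go (suc J) = begin
    2 * x * (D + x * f J) + 2 * P          ≡⟨ lem₁ x D (f J) P ⟩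
    2 * (x * D + x * (x * f J)) + 2 * P    ≤⟨ +-monoˡ-≤ (2 * P) (*-monoʳ-≤ 2 (+-monoʳ-≤ (x * D) (decay J))) ⟩
    2 * (x * D + P) + 2 * P                ≡⟨ lem₂ (x * D) P ⟩
    2 * (x * D + 2 * P)                    ≤⟨ *-monoʳ-≤ 2 (go J) ⟩
    2 * (x * (2 * P))                      ≡⟨ *-assoc 2 x (2 * P) ⟨
    2 * x * (2 * P)                        ∎
    where
    open ≤-Reasoning
    x D : ℕ
    x = 2 ^ J
    D = dyadicSum f J
    lem₁ : ∀ x d f p → 2 * x * (d + x * f) + 2 * p ≡ 2 * (x * d + x * (x * f)) + 2 * p
    lem₁ = solve-∀
    lem₂ : ∀ x p → 2 * (x + p) + 2 * p ≡ 2 * (x + 2 * p)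
    lem₂ = solve-∀

-- The layers start at A = 2K, so layer j is the tail bound for 2^j K. The constant is P A + 2A (2P)
-- = 10 K P.
sum-h-≤ : ∀ p .{{_ : NonZero p}} → Prime p → ∀ m .{{_ : NonZero m}} K → .{{_ : NonZero K}} →
          p ^ m ≤ K ^ suc m → sumOver (allVecs p m) (h p) ≤ 10 * K * p ^ m
sum-h-≤ p p-prime m@(suc m′) K P≤K^d = begin
  sumOver V (h p)
    ≤⟨ ∑-mono (λ t → layer-cake A (h p t) p (h<2^p t)) V ⟩
  (∑[ t ← V ] (A + 2 * A * D t))
    ≡⟨ trans (∑-+ (λ _ → A) (λ t → 2 * A * D t) V)
         (cong₂ _+_ (trans (∑-const A V) (cong (_* A) (length-allVecs p m)))
                    (trans (∑-*ˡ (2 * A) D V)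
                           (cong (2 * A *_) (∑-dyadicSum (λ t j → atLeast (2 ^ j * A) (h p t)) V p)))) ⟩
  P * A + 2 * A * dyadicSum N p
    ≤⟨ +-monoʳ-≤ (P * A) (*-monoʳ-≤ (2 * A) (dyadicSum-≤ N P decay p)) ⟩
  P * A + 2 * A * (2 * P)
    ≡⟨ lem P K ⟩
  10 * K * P ∎
  where
  open ≤-Reasoning
  V = allVecs p m
  P = p ^ m
  A = K + K
  D : Vec (Fin p) m → ℕ
  D t = dyadicSum (λ j → atLeast (2 ^ j * A) (h p t)) p
  N : ℕ → ℕ
  N j = ∑[ t ← V ] atLeast (2 ^ j * A) (h p t)
  instance
    P≢0 : NonZero P
    P≢0 = m^n≢0 p m
    A≢0 : NonZero A
    A≢0 = >-nonZero (<-≤-trans (>-nonZero⁻¹ K) (m≤m+n K K))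
  lem : ∀ p k → p * (k + k) + 2 * (k + k) * (2 * p) ≡ 10 * k * p
  lem = solve-∀
  -- Using p layers suffices, because h_p < p < 2^p.
  h<2^p : ∀ t → h p t < 2 ^ p * A
  h<2^p t = <-trans (h<p p (nonTrivial⇒n>1 p {{prime⇒nonTrivial p-prime}}) t)
                    (<-≤-trans (n<2^n p) (m≤m*n (2 ^ p) A))
  -- Here m ≥ 1 enters: the tail decays at least like 4^(-j), which beats the weight 2^j.
  square≤ : ∀ x .{{_ : NonZero x}} → x * x ≤ x ^ suc m
  square≤ x = *-monoʳ-≤ x (m≤m*n x (x ^ m′) {{m^n≢0 x m′}})
  decay : ∀ j → 2 ^ j * (2 ^ j * N j) ≤ P
  decay j = *-cancelˡ-≤ P (begin
    P * (x * (x * N j))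
      ≡⟨ lem₁ P x (N j) ⟩
    x * x * P * N j
      ≤⟨ *-monoˡ-≤ (N j) (*-mono-≤ (square≤ x) P≤K^d) ⟩
    x ^ suc m * K ^ suc m * N j
      ≡⟨ cong₂ _*_ (sym (^-distribʳ-* x K (suc m)))
           (∑-cong (λ t → cong (λ z → atLeast z (h p t)) (*-distribˡ-+ x K K)) V) ⟩
    (x * K) ^ suc m * (∑[ t ← V ] atLeast (x * K + x * K) (h p t))
      ≤⟨ tail-bound p p-prime m (x * K) ⟩
    P * P ∎)
    where
    x = 2 ^ j
    instance
      x≢0 : NonZero x
      x≢0 = m^n≢0 2 j
      xK≢0 : NonZero (x * K)
      xK≢0 = m*n≢0 x K
    lem₁ : ∀ p x n → p * (x * (x * n)) ≡ x * x * p * n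
    lem₁ = solve-∀

-- Take K = R + 1, where R is the integer part of p^(m/d). Maximality of R gives p^m ≤ K^d, and R ≥
-- 1 gives 10 (R + 1) ≤ 20 R.
sum-h-≤-root : ∀ p .{{_ : NonZero p}} → Prime p → ∀ m .{{_ : NonZero m}} →
  sumOver (allVecs p m) (h p) ≤ 20 * ⌊root⌋ (suc m) (p ^ m) * p ^ m
sum-h-≤-root p p-prime m = ≤-trans (sum-h-≤ p p-prime m (suc R) P≤)
  (*-monoˡ-≤ (p ^ m) (≤-trans (*-monoʳ-≤ 10 (+-monoˡ-≤ R 1≤R)) (≤-reflexive (lem R))))
  where
  R = ⌊root⌋ (suc m) (p ^ m)
  1≤R : 1 ≤ R
  1≤R = ⌊root⌋-maximal (suc m) (p ^ m) 1 (subst (_≤ p ^ m) (sym (^-zeroˡ (suc m))) (m^n>0 p m))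
  P≤ : p ^ m ≤ suc R ^ suc m
  P≤ with p ^ m ≤? suc R ^ suc m
  ... | yes le = le
  ... | no ¬le = contradiction (⌊root⌋-maximal (suc m) (p ^ m) (suc R) (<⇒≤ (≰⇒> ¬le))) (<-irrefl refl)
  lem : ∀ r → 10 * (r + r) ≡ 20 * r
  lem = solve-∀

-- Comparison with the real root and logarithm.

-- R 2^n competes in the maximum that defines the n-th approximant, as (R 2^n)^k ≤ a (2^n)^k. So
-- each approximant, and not only the limit, dominates the integer root.
root-≥ : ∀ k .{{_ : NonZero k}} a n → ℤ.+ ⌊root⌋ k a / 1 ℚ.≤ seq (root k a) n
root-≥ k a n = dyadic-≤ R 0 (⌊root⌋ k (a * (2 ^ n) ^ k)) n (subst (R * 2 ^ n ≤_) (sym (*-identityʳ _))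
  (⌊root⌋-maximal k (a * (2 ^ n) ^ k) (R * 2 ^ n) (subst (_≤ a * (2 ^ n) ^ k) (sym (^-distribʳ-* R (2 ^ n) k))
    (*-monoˡ-≤ ((2 ^ n) ^ k) (⌊root⌋-lower k a)))))
  where R = ⌊root⌋ k a

-- The first M = 2^n cells cover [1, 2] and contribute at least 1 / (2M) each; the later ones are
-- nonnegative.
log-≥½ : ∀ a → 1 < a → ∀ n → ½ ℚ.≤ seq (log a) n
log-≥½ a 1<a n = begin
  ½                          ≡⟨ frac-≡ 1 2 M (2 * M) (lem M) ⟩
  ℤ.+ M / (2 * M)              ≤⟨ initial M ≤-refl ⟩
  ∑ M f                      ≤⟨ extend ((a ∸ 1 ∸ 1) * M) ⟩
  ∑ ((a ∸ 1 ∸ 1) * M + M) f  ≡⟨ cong (λ N → ∑ N f) cells ⟩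
  ∑ ((a ∸ 1) * M) f          ∎
  where
  open ℚ.≤-Reasoning
  M = 2 ^ n
  f : ℕ → ℚ
  f k = ℤ.+ 1 / suc (M + k)
  instance
    M≢0 : NonZero M
    M≢0 = m^n≢0 2 n
    2M≢0 : NonZero (2 * M)
    2M≢0 = m*n≢0 2 M
  lem : ∀ x → 1 * (2 * x) ≡ x * 2
  lem = solve-∀
  cells : (a ∸ 1 ∸ 1) * M + M ≡ (a ∸ 1) * M
  cells = trans (+-comm _ M) (cong (_* M) (m+[n∸m]≡n (∸-monoˡ-≤ 1 1<a)))
  initial : ∀ j → j ≤ M → ℤ.+ j / (2 * M) ℚ.≤ ∑ j f
  initial zero    _   = frac-≤ 0 (2 * M) 0 1 z≤n
  initial (suc j) j<M = subst (ℚ._≤ ∑ (suc j) f)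
    (trans (frac-+ j 1 (2 * M)) (cong (λ i → ℤ.+ i / (2 * M)) (+-comm j 1)))
    (ℚ.+-mono-≤ (initial j (<⇒≤ j<M)) (frac-≤ 1 (2 * M) 1 (suc (M + j)) (*-monoʳ-≤ 1
      (subst₂ _≤_ (+-suc M j) (cong (M +_) (sym (+-identityʳ M))) (+-monoʳ-≤ M j<M)))))
  step : ∀ N → ∑ N f ℚ.≤ ∑ (suc N) f
  step N = subst (ℚ._≤ ∑ (suc N) f) (ℚ.+-identityʳ (∑ N f))
    (ℚ.+-monoʳ-≤ (∑ N f) (frac-≤ 0 1 1 (suc (M + N)) z≤n))
  extend : ∀ k → ∑ M f ℚ.≤ ∑ (k + M) f
  extend zero    = ℚ.≤-refl
  extend (suc k) = ℚ.≤-trans (extend k) (step (k + M))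

/1-* : ∀ a b → (ℤ.+ a / 1) ℚ.* (ℤ.+ b / 1) ≡ ℤ.+ (a * b) / 1
/1-* a b = ℚ.toℚᵘ-injective (ℚᵘ.≃-trans (ℚ.toℚᵘ-homo-* (ℤ.+ a / 1) (ℤ.+ b / 1))
  (ℚᵘ.≃-trans (ℚᵘ.*-cong (ℚ.toℚᵘ-fromℚᵘ (mkℚᵘ (ℤ.+ a) 0)) (ℚ.toℚᵘ-fromℚᵘ (mkℚᵘ (ℤ.+ b) 0)))
  (ℚᵘ.≃-trans (ℚᵘ.≃-reflexive (cong (λ i → mkℚᵘ i 0) (sym (ℤ.pos-* a b))))
              (ℚᵘ.≃-sym (ℚ.toℚᵘ-fromℚᵘ (mkℚᵘ (ℤ.+ (a * b)) 0))))))

theorem7p1 : ∀ (d : ℕ) .{{_ : NonZero d}} → d > 2 →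
    Σ[ C ∈ ℝ ] (∀ (p : ℕ) .{{_ : NonZero p}} → Prime p →
    fromℚ (𝔼 {d ∸ 1} p (h p)) ≤ᵣ C *ᵣ p ^[ d ∸ 1 / d ] *ᵣ log p)
theorem7p1 (suc zero) (s≤s ())
-- The constant 40 is the 20 of `sum-h-≤-root` doubled, to pay for log p ≥ 1/2. The bound holds for
-- every approximant, so the threshold index is 0 and ε is only added at the end.
theorem7p1 (suc m@(suc _)) _ = fromℚ (ℤ.+ 40 / 1) , λ p p-prime ε 0<ε → 0 , λ n _ → begin
  𝔼 {m} p (h p)
    ≤⟨ frac-≤ (sumOver (allVecs p m) (h p)) (p ^ m) (20 * R p) 1 {{m^n≢0 p m}}
         (subst (_≤ 20 * R p * p ^ m) (sym (*-identityʳ _)) (sum-h-≤-root p p-prime m)) ⟩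
  ℤ.+ (20 * R p) / 1
    ≡⟨ /1-* 20 (R p) ⟨
  (ℤ.+ 20 / 1) ℚ.* (ℤ.+ R p / 1)
    ≡⟨ ℚ.*-comm (ℤ.+ 20 / 1) (ℤ.+ R p / 1) ⟩
  (ℤ.+ R p / 1) ℚ.* ((ℤ.+ 40 / 1) ℚ.* ½)
    ≡⟨ ℚ.*-assoc (ℤ.+ R p / 1) (ℤ.+ 40 / 1) ½ ⟨
  (ℤ.+ R p / 1) ℚ.* (ℤ.+ 40 / 1) ℚ.* ½
    ≡⟨ cong (ℚ._* ½) (ℚ.*-comm (ℤ.+ R p / 1) (ℤ.+ 40 / 1)) ⟩
  (ℤ.+ 40 / 1) ℚ.* (ℤ.+ R p / 1) ℚ.* ½
    ≤⟨ ℚ.*-monoʳ-≤-nonNeg ½ (ℚ.*-monoˡ-≤-nonNeg (ℤ.+ 40 / 1) (root-≥ (suc m) (p ^ m) n)) ⟩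
  (ℤ.+ 40 / 1) ℚ.* seq (p ^[ m / suc m ]) n ℚ.* ½
    ≤⟨ ℚ.*-monoˡ-≤-nonNeg ((ℤ.+ 40 / 1) ℚ.* seq (p ^[ m / suc m ]) n) {{ℚ.nonNegative (nonneg p n)}}
         (log-≥½ p (nonTrivial⇒n>1 p {{prime⇒nonTrivial p-prime}}) n) ⟩
  (ℤ.+ 40 / 1) ℚ.* seq (p ^[ m / suc m ]) n ℚ.* seq (log p) n
    ≡⟨ ℚ.+-identityʳ _ ⟨
  (ℤ.+ 40 / 1) ℚ.* seq (p ^[ m / suc m ]) n ℚ.* seq (log p) n ℚ.+ 0ℚ
    ≤⟨ ℚ.+-monoʳ-≤ ((ℤ.+ 40 / 1) ℚ.* seq (p ^[ m / suc m ]) n ℚ.* seq (log p) n) (ℚ.<⇒≤ 0<ε) ⟩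
  (ℤ.+ 40 / 1) ℚ.* seq (p ^[ m / suc m ]) n ℚ.* seq (log p) n ℚ.+ ε ∎
  where
  open ℚ.≤-Reasoning
  R : ℕ → ℕ
  R p = ⌊root⌋ (suc m) (p ^ m)
  nonneg : ∀ p n → 0ℚ ℚ.≤ (ℤ.+ 40 / 1) ℚ.* seq (p ^[ m / suc m ]) n
  nonneg p n = ℚ.*-monoˡ-≤-nonNeg (ℤ.+ 40 / 1) (ℚ.≤-trans (frac-≤ 0 1 (R p) 1 z≤n) (root-≥ (suc m) (p ^ m) n))
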